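{- The map $\varphi_0$ defined by $\varphi_0(x)=x^\perp\cap Q_0$ for every point $x\in Q\setminus Q_0$, and $\varphi_0(\hat l)=\{x^\perp\cap Q_0: x\in\hat l\}$ for every line $\hat l$ of $\hat{\mathcal X}$, is well defined (i.e. $x^\perp\cap Q_0$ is an elliptic ovoid of $Q_0$ and $\varphi_0(\hat l)$ is a rosette based at $l^\infty$) and is a $2$-fold covering from $\hat{\mathcal X}$ to $\mathcal X$.
   Context: Let $q=2^n$, $V=V(6,q)$, and let $Q=Q^-(5,q)$ be the set of singular points of a non-degenerate quadratic form $f$ of Witt index $2$ on $V$, viewed as a generalized quadrangle of order $(q,q^2)$ whose lines are the totally singular lines of $\mathrm{PG}(V)$. Let $\perp$ denote the polarity of $\mathrm{PG}(V)$ defined by the bilinear form associated with $f$. Let $H_0$ be a hyperplane of $\mathrm{PG}(V)$ with $Q_0:=Q\cap H_0\cong Q(4,q)$ a parabolic quadric, and let $n_0:=H_0^\perp$ (the nucleus of $Q_0$, a point not on $Q$). An elliptic ovoid of $Q_0$ is a set $X=S\cap Q_0$ where $S$ is a $3$-dimensional projective subspace of $H_0$ meeting $Q_0$ in an elliptic quadric $Q^-(3,q)$. Two distinct elliptic ovoids meet in one point or in a conic; they are tangent if they meet in exactly one point. A rosette based at a point $p\in Q_0$ is a set of $q$ elliptic ovoids pairwise meeting exactly in $\{p\}$. The geometry $\mathcal X$ has the elliptic ovoids of $Q_0$ as points, the rosettes as lines, incidence being membership. The affine geometry $\hat{\mathcal X}$ has as points the points of $Q\setminus Q_0$ and as lines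 the sets $\hat l=l\setminus\{l^\infty\}$, where $l$ ranges over the lines of $Q$ not contained in $Q_0$ and $l^\infty:=l\cap Q_0$; incidence is inclusion. A morphism of rank-2 geometries (mapping points to points, lines to lines, preserving incidence) is a covering if for every point $x$ and line $L$ it induces bijections from the points of $L$ onto the points of the image of $L$ and from the lines through $x$ onto the lines through the image of $x$; it is $2$-fold if all fibres have size $2$. -}

module Defs where

open import Algebra.Bundles using (CommutativeRing; RawMonoid)
open import Algebra.Structures using (IsCommutativeRing)
import Algebra.Definitions.RawMonoid as RawMonoidDefs
open import Data.Fin.Base using (Fin)
open import Data.Nat.Base as ℕ using (ℕ)
open import Data.Product.Base using (Σ; ∃; _×_; _,_; proj₁; proj₂)
open import Data.Vec.Base using (Vec; map; replicate; zipWith)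
open import Data.Vec.Properties using (map-cong; map-id)
open import Data.Vec.Functional using (Vector)
open import Function.Bundles using (Inverse; _↔_)
open import Function.Definitions using (Congruent; Bijective)
open import Level using (Level; _⊔_; 0ℓ) renaming (suc to lsuc)
open import Relation.Binary.Bundles using (Setoid)
open import Relation.Binary.Core using (REL)
open import Relation.Binary.Definitions using (_Respects_)
import Relation.Binary.Construct.On as On
open import Relation.Binary.PropositionalEquality
  using (_≡_; _≢_; sym; trans; subst; setoid)
open import Relation.Nullary.Negation.Core using (¬_)
open import Relation.Unary
  using (Pred; _∈_; _⊆_; _≐_; _∩_; _∖_; U)
open import Relation.Unary.Relation.Binary.Equality using (≐-setoid)

private
  variable
    a p ℓ : Level

Sub : (S : Setoid a ℓ) → Pred (Setoid.Carrier S) p → Setoid (a ⊔ p) ℓ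
Sub S P = On.setoid {B = ∃ P} S proj₁

HasSize : Setoid a ℓ → ℕ → Set (a ⊔ ℓ)
HasSize S k = Inverse S (setoid (Fin k))

record Geometry (a ℓ b m i : Level) : Set (lsuc (a ⊔ ℓ ⊔ b ⊔ m ⊔ i)) where
  field
    Points : Setoid a ℓ
    Lines  : Setoid b m

  open Setoid Points public using () renaming (Carrier to Point; _≈_ to _≈ᴾ_)
  open Setoid Lines  public using () renaming (Carrier to Line;  _≈_ to _≈ᴸ_)

  field
    _I_     : REL Point Line i
    I-respᴾ : ∀ {x y L} → x ≈ᴾ y → x I L → y I L
    I-respᴸ : ∀ {x L M} → L ≈ᴸ M → x I L → x I M

  PointsOn : Line → Setoid (a ⊔ i) ℓ
  PointsOn L = Sub Points (_I L)

  LinesThrough : Point → Setoid (b ⊔ i) m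
  LinesThrough x = Sub Lines (x I_)

module _ {a ℓ b m i a′ ℓ′ b′ m′ i′ : Level}
         (G : Geometry a ℓ b m i) (H : Geometry a′ ℓ′ b′ m′ i′) where

  private
    module G = Geometry G
    module H = Geometry H

  record IsMorphism (φᴾ : G.Point → H.Point) (φᴸ : G.Line → H.Line)
                    : Set (a ⊔ ℓ ⊔ b ⊔ m ⊔ i ⊔ a′ ⊔ ℓ′ ⊔ b′ ⊔ m′ ⊔ i′) where
    field
      congᴾ : Congruent G._≈ᴾ_ H._≈ᴾ_ φᴾ
      congᴸ : Congruent G._≈ᴸ_ H._≈ᴸ_ φᴸ
      pres  : ∀ {x L} → x G.I L → φᴾ x H.I φᴸ L

    onPoints : ∀ L → Setoid.Carrier (G.PointsOn L) →
                     Setoid.Carrier (H.PointsOn (φᴸ L))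
    onPoints L (x , xIL) = φᴾ x , pres xIL

    onLines : ∀ x → Setoid.Carrier (G.LinesThrough x) →
                    Setoid.Carrier (H.LinesThrough (φᴾ x))
    onLines x (L , xIL) = φᴸ L , pres xIL

  record IsCovering (φᴾ : G.Point → H.Point) (φᴸ : G.Line → H.Line)
                    : Set (a ⊔ ℓ ⊔ b ⊔ m ⊔ i ⊔ a′ ⊔ ℓ′ ⊔ b′ ⊔ m′ ⊔ i′) where
    field
      isMorphism : IsMorphism φᴾ φᴸ

    open IsMorphism isMorphism public

    field
      bijᴾ : ∀ L → Bijective (Setoid._≈_ (G.PointsOn L))
                             (Setoid._≈_ (H.PointsOn (φᴸ L))) (onPoints L)
      bijᴸ : ∀ x → Bijective (Setoid._≈_ (G.LinesThrough x))
                             (Setoid._≈_ (H.LinesThrough (φᴾ x))) (onLines x)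

  record IsFoldCovering (k : ℕ) (φᴾ : G.Point → H.Point) (φᴸ : G.Line → H.Line)
                        : Set (a ⊔ ℓ ⊔ b ⊔ m ⊔ i ⊔ a′ ⊔ ℓ′ ⊔ b′ ⊔ m′ ⊔ i′) where
    field
      isCovering : IsCovering φᴾ φᴸ
      fibreᴾ     : ∀ y → HasSize (Sub G.Points (λ x → φᴾ x H.≈ᴾ y)) k
      fibreᴸ     : ∀ M → HasSize (Sub G.Lines  (λ L → φᴸ L H.≈ᴸ M)) k

    open IsCovering isCovering public

record FiniteField (q : ℕ) : Set₁ where
  infixl 7 _*_
  infixl 6 _+_ _-_
  infix  8 -_
  field
    Carrier           : Set
    _+_ _*_           : Carrier → Carrier → Carrier
    -_                : Carrier → Carrier
    0# 1#             : Carrier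
    isCommutativeRing : IsCommutativeRing _≡_ _+_ _*_ -_ 0# 1#
    0≢1               : 0# ≢ 1#
    inverse           : ∀ x → x ≢ 0# → ∃ λ y → x * y ≡ 1#
    finite            : Carrier ↔ Fin q

  commutativeRing : CommutativeRing 0ℓ 0ℓ
  commutativeRing = record { isCommutativeRing = isCommutativeRing }

  _-_ : Carrier → Carrier → Carrier
  x - y = x + (- y)

module VectorSpace {q : ℕ} (F : FiniteField q) (d : ℕ) where

  private
    module F = FiniteField F

  infixl 6 _+ᵛ_
  infixr 7 _•_

  V : Set
  V = Vec F.Carrier d

  0ᵛ : V
  0ᵛ = replicate d F.0#

  _+ᵛ_ : V → V → V
  _+ᵛ_ = zipWith F._+_

  _•_ : F.Carrier → V → V
  c • v = map (c F.*_) v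

  +ᵛ-rawMonoid : RawMonoid 0ℓ 0ℓ
  +ᵛ-rawMonoid = record { _≈_ = _≡_ ; _∙_ = _+ᵛ_ ; ε = 0ᵛ }

  open RawMonoidDefs +ᵛ-rawMonoid using (sum)

  lincomb : ∀ {k} → Vector F.Carrier k → Vector V k → V
  lincomb c b = sum (λ i → c i • b i)

  record Subspace : Set₁ where
    field
      ∣_∣      : Pred V 0ℓ
      0-closed : 0ᵛ ∈ ∣_∣
      +-closed : ∀ {u v} → u ∈ ∣_∣ → v ∈ ∣_∣ → u +ᵛ v ∈ ∣_∣
      •-closed : ∀ c {v} → v ∈ ∣_∣ → c • v ∈ ∣_∣

  open Subspace public

  whole : Subspace
  whole = record
    { ∣_∣ = U ; 0-closed = _ ; +-closed = _ ; •-closed = _ }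

  LinearlyIndependent : ∀ {k} → Vector V k → Set
  LinearlyIndependent b = ∀ c → lincomb c b ≡ 0ᵛ → ∀ i → c i ≡ F.0#

  Span : ∀ {k} → Vector V k → Pred V 0ℓ
  Span b v = ∃ λ c → v ≡ lincomb c b

  -- Vector space dimension, one more than the projective dimension.
  HasDim : Subspace → ℕ → Set
  HasDim W k = Σ (Vector V k) λ b → LinearlyIndependent b × ∣ W ∣ ≐ Span b

  -- A point of PG(V) is represented by a nonzero vector; two of them are the
  -- same point when they have the same multiples.
  ProjPoint : Set
  ProjPoint = ∃ λ (v : V) → v ≢ 0ᵛ

  ⟨_⟩ : ProjPoint → Pred V 0ℓ
  ⟨ v , _ ⟩ u = ∃ λ c → u ≡ c • v

  ProjPoints : Setoid 0ℓ 0ℓ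
  ProjPoints = On.setoid (≐-setoid V 0ℓ) ⟨_⟩

  open Setoid ProjPoints public using () renaming (_≈_ to _∼_)

  pts : Subspace → Pred ProjPoint 0ℓ
  pts W (v , _) = v ∈ ∣ W ∣

  ｛_｝ᴾ : ProjPoint → Pred ProjPoint 0ℓ
  ｛ p ｝ᴾ x = x ∼ p

  •-identityˡ : ∀ v → F.1# • v ≡ v
  •-identityˡ v =
    trans (map-cong (CommutativeRing.*-identityˡ F.commutativeRing) v) (map-id v)

  pts-resp : ∀ W → pts W Respects _∼_
  pts-resp W {x} {y , _} (_ , ⟨y⟩⊆⟨x⟩) x∈W
    with c , eq ← ⟨y⟩⊆⟨x⟩ {y} (F.1# , sym (•-identityˡ y))
    = subst (_∈ ∣ W ∣) (sym eq) (•-closed W c x∈W)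

  polar : (V → F.Carrier) → V → V → F.Carrier
  polar f u v = f (u +ᵛ v) F.- f u F.- f v

  record IsBilinear (B : V → V → F.Carrier) : Set where
    field
      +ˡ : ∀ u v w → B (u +ᵛ v) w ≡ B u w F.+ B v w
      +ʳ : ∀ u v w → B u (v +ᵛ w) ≡ B u v F.+ B u w
      •ˡ : ∀ c u v → B (c • u) v ≡ c F.* B u v
      •ʳ : ∀ c u v → B u (c • v) ≡ c F.* B u v

  record IsQuadraticForm (f : V → F.Carrier) : Set where
    field
      homogeneous    : ∀ c v → f (c • v) ≡ c F.* c F.* f v
      polar-bilinear : IsBilinear (polar f)

  -- The restriction of f to W is non-degenerate: the radical of the polar form
  -- contains no nonzero singular vector.  In characteristic 2 and odd
  -- dimension, the radical itself is never zero, so one cannot ask for more.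
  NonDegenerateOn : (V → F.Carrier) → Subspace → Set
  NonDegenerateOn f W =
    ∀ v → v ∈ ∣ W ∣ → f v ≡ F.0# →
    (∀ w → w ∈ ∣ W ∣ → polar f v w ≡ F.0#) → v ≡ 0ᵛ

  TotallySingular : (V → F.Carrier) → Subspace → Set
  TotallySingular f W = ∀ v → v ∈ ∣ W ∣ → f v ≡ F.0#

  record HasWittIndexOn (f : V → F.Carrier) (W : Subspace) (w : ℕ) : Set₁ where
    field
      attained : Σ Subspace λ T →
                 ∣ T ∣ ⊆ ∣ W ∣ × TotallySingular f T × HasDim T w
      maximal  : ∀ T k → ∣ T ∣ ⊆ ∣ W ∣ → TotallySingular f T → HasDim T k →
                 k ℕ.≤ w

module Quadric {q d : ℕ} (F : FiniteField q)
               (f : Vec (FiniteField.Carrier F) d → FiniteField.Carrier F)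
               (H₀ : VectorSpace.Subspace F d) where

  open FiniteField F using (0#)
  open VectorSpace F d

  Q : Pred ProjPoint 0ℓ
  Q (v , _) = f v ≡ 0#

  Q₀ : Pred ProjPoint 0ℓ
  Q₀ = Q ∩ pts H₀

  _^⊥ : ProjPoint → Pred ProjPoint 0ℓ
  ((u , _) ^⊥) (v , _) = polar f u v ≡ 0#

  -- The quadric f = 0 in S is a Q⁻(3,q): the form has rank 4 and Witt index 1.
  record IsEllipticSolid (S : Subspace) : Set₁ where
    field
      inside        : ∣ S ∣ ⊆ ∣ H₀ ∣
      dimension     : HasDim S 4
      nonDegenerate : NonDegenerateOn f S
      wittIndex     : HasWittIndexOn f S 1

  IsEllipticOvoid : Pred ProjPoint 0ℓ → Set₁
  IsEllipticOvoid X = Σ Subspace λ S → IsEllipticSolid S × X ≐ (pts S ∩ Q₀)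

  Ovoids : Setoid (lsuc 0ℓ) 0ℓ
  Ovoids = Sub (≐-setoid ProjPoint 0ℓ) IsEllipticOvoid

  open Setoid Ovoids public using () renaming (Carrier to Ovoid; _≈_ to _≈ᴼ_)

  record IsRosetteBasedAt (p : ProjPoint) (R : Pred Ovoid 0ℓ) : Set₁ where
    field
      base     : p ∈ Q₀
      resp     : R Respects _≈ᴼ_
      size     : HasSize (Sub Ovoids R) q
      pairwise : ∀ X Y → X ∈ R → Y ∈ R → ¬ (X ≈ᴼ Y) →
                 (proj₁ X ∩ proj₁ Y) ≐ ｛ p ｝ᴾ

  IsRosette : Pred Ovoid 0ℓ → Set₁
  IsRosette R = ∃ λ p → IsRosetteBasedAt p R

  Rosettes : Setoid (lsuc 0ℓ) (lsuc 0ℓ)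
  Rosettes = Sub (≐-setoid Ovoid 0ℓ) IsRosette

  𝒳 : Geometry (lsuc 0ℓ) 0ℓ (lsuc 0ℓ) (lsuc 0ℓ) 0ℓ
  𝒳 = record
    { Points  = Ovoids
    ; Lines   = Rosettes
    ; _I_     = λ X R → X ∈ proj₁ R
    ; I-respᴾ = λ {X} {Y} {R} → IsRosetteBasedAt.resp (proj₂ (proj₂ R)) {X} {Y}
    ; I-respᴸ = λ R≐S → proj₁ R≐S
    }

  record AffineLine : Set₁ where
    field
      line            : Subspace
      dimension       : HasDim line 2
      totallySingular : TotallySingular f line
      notInQ₀         : ¬ (pts line ⊆ Q₀)

  open AffineLine public using (line)

  -- l^∞ as a set of points; that it is a single point is part of WellDefined.
  _^∞ : AffineLine → Pred ProjPoint 0ℓ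
  l ^∞ = pts (line l) ∩ Q₀

  hat : AffineLine → Pred ProjPoint 0ℓ
  hat l = pts (line l) ∖ (l ^∞)

  𝒳̂ : Geometry 0ℓ 0ℓ (lsuc 0ℓ) 0ℓ 0ℓ
  𝒳̂ = record
    { Points  = Sub ProjPoints (Q ∖ Q₀)
    ; Lines   = On.setoid (≐-setoid ProjPoint 0ℓ) hat
    ; _I_     = λ x l → proj₁ x ∈ hat l
    ; I-respᴾ = λ { {x , xQ , _} {y , yQ , y∉Q₀} {l} x∼y (x∈l , _) →
                    pts-resp (line l) {x} {y} x∼y x∈l , λ (_ , y∈Q₀) → y∉Q₀ y∈Q₀ }
    ; I-respᴸ = λ {x} l≐m → proj₁ l≐m {proj₁ x}
    }

  AffinePoint : Set
  AffinePoint = Geometry.Point 𝒳̂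

  φ₀-pt : AffinePoint → Pred ProjPoint 0ℓ
  φ₀-pt (x , _) = (x ^⊥) ∩ Q₀

  φ₀-line : AffineLine → Pred Ovoid 0ℓ
  φ₀-line l X = Σ AffinePoint λ x → proj₁ x ∈ hat l × proj₁ X ≐ φ₀-pt x

  record WellDefined : Set₁ where
    field
      ovoid   : ∀ x → IsEllipticOvoid (φ₀-pt x)
      rosette : ∀ l → ∃ λ p → (l ^∞) ≐ ｛ p ｝ᴾ × IsRosetteBasedAt p (φ₀-line l)

    φ₀ᴾ : Geometry.Point 𝒳̂ → Geometry.Point 𝒳
    φ₀ᴾ x = φ₀-pt x , ovoid x

    φ₀ᴸ : Geometry.Line 𝒳̂ → Geometry.Line 𝒳
    φ₀ᴸ l = φ₀-line l , proj₁ (rosette l) , proj₂ (proj₂ (rosette l))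

{-# OPTIONS --safe #-}

-- The hyperplane H₀ is ν^⊥ for a vector ν with f ν = 1, and every point of Q ∖ Q₀ has a unique
-- representative x with B ν x = 1.  The solid x^⊥ ∩ H₀ is then a complement of ⟨x, ν⟩ orthogonal to it,
-- which makes it elliptic.  A second representative w can be written x + u + a ν with u in that solid
-- and f u = a² + a.  If w has the same ovoid as x, then u = 0, because the singular vectors span the
-- solid, so w is x or its twin x + ν; if the two ovoids meet only in ⟨p⟩, then u is a multiple c p, so w
-- or its twin lies on the line ⟨x, p⟩.  Hence the rosettes through the ovoid of x are images of lines
-- through x: one inclusion is the tangency statement, the other follows by counting to q.  Twins are
-- never orthogonal, so a line contains no pair of twins and the fibres have exactly two elements.
--
-- Every elliptic solid S arises in this way.  Write S = ⟨p, h⟩ ⊥ ⟨e, k⟩ with p singular, f e = 1,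
-- B e k = 1 and ⟨e, k⟩ anisotropic, so that f k is not of the form s² + s.  Choose a orthogonal to S with
-- B ν a = 1.  Since the values s² + s form a subgroup of index 2, f a or f a + f k is one of them.  In the
-- first case a + s ν is singular for some s, which is the required point; in the second ⟨ν, a⟩ and
-- ⟨e, k⟩ are isometric, so their sum contains a totally singular plane, which together with p
-- contradicts Witt index 2.
module Submission where

open import Defs
open import Algebra.Bundles using (CommutativeRing; RawRing)
import Algebra.Properties.CommutativeMonoid.Sum as Sum
import Algebra.Properties.Ring as RingProperties
import Algebra.Properties.Semiring.Mult as Mult
import Algebra.Solver.Ring as RingSolver
open import Algebra.Solver.Ring.AlmostCommutativeRing
  using (fromCommutativeRing; _-Raw-AlmostCommutative⟶_)
open import Data.Bool.Base using (Bool; true; false)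
open import Data.Bool.Properties using (xor-∧-commutativeRing)
open import Data.Fin.Base using (Fin; zero; suc; punchOut; _<_)
import Data.Fin.Properties as Fin
open import Data.Maybe.Base using (Maybe; just; nothing)
open import Data.Nat.Base as ℕ using (ℕ; zero; suc; _^_)
import Data.Nat.Properties as ℕ
open import Data.Product.Base using (Σ; ∃; _×_; _,_; proj₁; proj₂)
open import Data.Sum.Base using (_⊎_; inj₁; inj₂; [_,_]′)
open import Data.Vec.Base using (Vec; []; _∷_; lookup; map; _[_]≔_)
import Data.Vec.Functional as F
open import Data.Vec.Properties
  using (lookup-map; lookup-zipWith; lookup-replicate; lookup∘update; lookup∘update′; ≡-dec)
open import Data.Vec.Relation.Binary.Pointwise.Extensional using (ext; Pointwise-≡⇒≡)
open import Function.Base using (_∘_)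
open import Function.Bundles using (Inverse; _↔_; mk↔ₛ′)
open import Level using (0ℓ; Level)
open import Relation.Binary.Bundles using (Setoid)
open import Relation.Binary.Definitions using (DecidableEquality; _Respects_)
open import Relation.Binary.PropositionalEquality
  using (_≡_; _≢_; refl; sym; trans; cong; cong₂; subst; subst₂; ≢-sym; module ≡-Reasoning)
open import Relation.Nullary.Decidable using (Dec; yes; no; map′; ¬?; decidable-stable)
open import Relation.Nullary.Negation using (¬_; contradiction)
open import Relation.Unary using (_∈_; _∉_; _⊆_; _≐_; Decidable; Pred; _∩_)
open import Relation.Unary.Properties using (≐-refl; ≐-sym; ≐-trans)

-- The pigeonhole principle.

injective⇒surjective : ∀ {n} {g : Fin n → Fin n} → (∀ {i j} → g i ≡ g j → i ≡ j) →
                       ∀ i → ∃ λ j → g j ≡ i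
injective⇒surjective {suc n} {g} inj i with Fin.any? (λ j → g j Fin.≟ i)
... | yes hit = hit
-- Punching out the missed value `i` turns `g` into an injection of `Fin (suc n)` into `Fin n`.
... | no miss = contradiction
  (Fin.injective⇒≤ {f = λ j → punchOut (i≢g j)}
    (λ {j} {k} eq → inj (Fin.punchOut-injective (i≢g j) (i≢g k) eq)))
  ℕ.1+n≰n
  where
  i≢g : ∀ j → i ≢ g j
  i≢g j i≡gj = miss (j , sym i≡gj)

-- Finite fields, and the characteristic of a field of order a power of 2.

Characteristic2 : ∀ {q} → FiniteField q → Set
Characteristic2 F = 1# + 1# ≡ 0#
  where open FiniteField F

module FieldProperties {q : ℕ} (F : FiniteField q) where
  open FiniteField F
  open CommutativeRing commutativeRing public
    using ( +-assoc; +-comm; +-identityˡ; +-identityʳ; -‿inverseˡ; -‿inverseʳ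
          ; *-assoc; *-comm; *-identityˡ; *-identityʳ; zeroˡ; zeroʳ)
  open Inverse finite public using () renaming (to to index; from to element)
  open RingProperties (CommutativeRing.ring commutativeRing) using (+-identityʳ-unique)

  element-index : ∀ x → element (index x) ≡ x
  element-index = Inverse.strictlyInverseʳ finite

  index-element : ∀ i → index (element i) ≡ i
  index-element = Inverse.strictlyInverseˡ finite

  index-injective : ∀ {x y} → index x ≡ index y → x ≡ y
  index-injective {x} {y} eq =
    trans (sym (element-index x)) (trans (cong element eq) (element-index y))

  infix 4 _≟_
  _≟_ : DecidableEquality Carrier
  x ≟ y = map′ index-injective (cong index) (index x Fin.≟ index y)

  any? : ∀ {P : Carrier → Set} → (∀ x → Dec (P x)) → Dec (∃ P)
  any? {P} P? = map′ (λ (i , p) → element i , p)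
    (λ (x , p) → index x , subst P (sym (element-index x)) p) (Fin.any? (P? ∘ element))

  injective⇒surjectiveᶠ : {g : Carrier → Carrier} → (∀ {x y} → g x ≡ g y → x ≡ y) →
                          ∀ y → ∃ λ x → g x ≡ y
  injective⇒surjectiveᶠ {g} inj y
    with i , eq ← injective⇒surjective {g = index ∘ g ∘ element}
           (λ eq → trans (sym (index-element _))
                     (trans (cong index (inj (index-injective eq))) (index-element _)))
           (index y)
    = element i , index-injective eq

  opaque
    x*y≡0⇒x≡0∨y≡0 : ∀ {x y} → x * y ≡ 0# → x ≡ 0# ⊎ y ≡ 0#
    x*y≡0⇒x≡0∨y≡0 {x} {y} xy≡0 with x ≟ 0#
    ... | yes x≡0 = inj₁ x≡0
    ... | no  x≢0 with x⁻¹ , xx⁻¹≡1 ← inverse x x≢0 = inj₂ (begin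
      y              ≡⟨ *-identityˡ y ⟨
      1# * y         ≡⟨ cong (_* y) (trans (sym xx⁻¹≡1) (*-comm x x⁻¹)) ⟩
      x⁻¹ * x * y    ≡⟨ *-assoc x⁻¹ x y ⟩
      x⁻¹ * (x * y)  ≡⟨ cong (x⁻¹ *_) xy≡0 ⟩
      x⁻¹ * 0#       ≡⟨ zeroʳ x⁻¹ ⟩
      0#             ∎)
      where open ≡-Reasoning

  open Sum (CommutativeRing.+-commutativeMonoid commutativeRing)
    using (sum; sum-permute; sum-cong-≗; ∑-distrib-+; sum-replicate)
  open Mult (CommutativeRing.semiring commutativeRing)
    using (×1-homo-*) renaming (_×_ to _·_)

  opaque
    -- The sum of all elements is invariant under the translation by 1.
    q·1≡0 : q · 1# ≡ 0#
    q·1≡0 = +-identityʳ-unique (sum element) (q · 1#) (sym (begin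
      sum element                                  ≡⟨ sum-permute element translation ⟩
      sum (λ i → element (index (element i + 1#))) ≡⟨ sum-cong-≗ (λ i → element-index (element i + 1#)) ⟩
      sum (λ i → element i + 1#)                   ≡⟨ ∑-distrib-+ element (λ _ → 1#) ⟩
      sum element + sum (λ (_ : Fin q) → 1#)       ≡⟨ cong (sum element +_) (sum-replicate q) ⟩
      sum element + q · 1#                         ∎))
      where
      open ≡-Reasoning
      shift-shift : ∀ i x y → x + y ≡ 0# → index (element (index (element i + x)) + y) ≡ i
      shift-shift i x y x+y≡0 = begin
        index (element (index (element i + x)) + y) ≡⟨ cong (λ z → index (z + y)) (element-index _) ⟩
        index (element i + x + y)                   ≡⟨ cong index (+-assoc (element i) x y) ⟩
        index (element i + (x + y))                 ≡⟨ cong (λ z → index (element i + z)) x+y≡0 ⟩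
        index (element i + 0#)                      ≡⟨ cong index (+-identityʳ (element i)) ⟩
        index (element i)                           ≡⟨ index-element i ⟩
        i                                           ∎
      translation : Fin q ↔ Fin q
      translation = mk↔ₛ′ (λ i → index (element i + 1#)) (λ i → index (element i + (- 1#)))
        (λ i → shift-shift i (- 1#) 1# (-‿inverseˡ 1#))
        (λ i → shift-shift i 1# (- 1#) (-‿inverseʳ 1#))

  opaque
    -- The multiple of 1 by a product is the product of the multiples, so without zero divisors some
    -- factor 2 already kills 1; the empty product would give 1 = 0.
    2ⁿ·1≡0⇒1+1≡0 : ∀ n → (2 ^ n) · 1# ≡ 0# → 1# + 1# ≡ 0#
    2ⁿ·1≡0⇒1+1≡0 zero    eq = contradiction (sym (trans (sym (+-identityʳ 1#)) eq)) 0≢1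
    2ⁿ·1≡0⇒1+1≡0 (suc n) eq with x*y≡0⇒x≡0∨y≡0 (trans (sym (×1-homo-* 2 (2 ^ n))) eq)
    ... | inj₁ 2·1≡0  = trans (cong (1# +_) (sym (+-identityʳ 1#))) 2·1≡0
    ... | inj₂ 2ⁿ·1≡0 = 2ⁿ·1≡0⇒1+1≡0 n 2ⁿ·1≡0

opaque
  1+1≡0 : ∀ n (F : FiniteField (2 ^ n)) → Characteristic2 F
  1+1≡0 n F = 2ⁿ·1≡0⇒1+1≡0 n q·1≡0
    where open FieldProperties F

-- Characteristic 2: ring solver, square roots and the map `℘`.

module Char2 {q : ℕ} (F : FiniteField q)
             (1+1≡0 : Characteristic2 F) where
  open FiniteField F
  open FieldProperties F public
  open RingProperties (CommutativeRing.ring commutativeRing) using (-0#≈0#)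

  private
    -- Coefficients from the field of two elements let the ring solver cancel `x + x` and ignore
    -- signs.
    Bool-rawRing : RawRing 0ℓ 0ℓ
    Bool-rawRing = CommutativeRing.rawRing xor-∧-commutativeRing

    -1≡1 : - 1# ≡ 1#
    -1≡1 = begin
      - 1#             ≡⟨ +-identityʳ _ ⟨
      - 1# + 0#        ≡⟨ cong (- 1# +_) 1+1≡0 ⟨
      - 1# + (1# + 1#) ≡⟨ +-assoc _ _ _ ⟨
      - 1# + 1# + 1#   ≡⟨ cong (_+ 1#) (-‿inverseˡ 1#) ⟩
      0# + 1#          ≡⟨ +-identityˡ 1# ⟩
      1#               ∎
      where open ≡-Reasoning

    ⟦_⟧ᵇ : Bool → Carrier
    ⟦ true ⟧ᵇ = 1#
    ⟦ false ⟧ᵇ = 0#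

    morphism : Bool-rawRing -Raw-AlmostCommutative⟶ fromCommutativeRing commutativeRing
    morphism = record
      { ⟦_⟧    = ⟦_⟧ᵇ
      ; +-homo = λ { true true → sym 1+1≡0 ; true false → sym (+-identityʳ 1#)
                   ; false y → sym (+-identityˡ _) }
      ; *-homo = λ { true y → sym (*-identityˡ _) ; false y → sym (zeroˡ _) }
      ; -‿homo = λ { true → sym -1≡1 ; false → sym -0#≈0# }
      ; 0-homo = refl
      ; 1-homo = refl
      }

    ⟦_⟧ᵇ≟⟦_⟧ᵇ : ∀ a b → Maybe (⟦ a ⟧ᵇ ≡ ⟦ b ⟧ᵇ)
    ⟦ true  ⟧ᵇ≟⟦ true  ⟧ᵇ = just refl
    ⟦ false ⟧ᵇ≟⟦ false ⟧ᵇ = just refl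
    ⟦ _     ⟧ᵇ≟⟦ _     ⟧ᵇ = nothing

  open RingSolver Bool-rawRing (fromCommutativeRing commutativeRing) morphism ⟦_⟧ᵇ≟⟦_⟧ᵇ public
    using (Polynomial; con; _:+_; _:*_; _:-_; _:=_; solve)

  :1 :0 : ∀ {n} → Polynomial n
  :1 = con true
  :0 = con false

  opaque
    x+x≡0 : ∀ x → x + x ≡ 0#
    x+x≡0 = solve 1 (λ x → x :+ x := :0) refl

    x+y≡0⇒x≡y : ∀ {x y} → x + y ≡ 0# → x ≡ y
    x+y≡0⇒x≡y {x} {y} eq = begin
      x           ≡⟨ solve 2 (λ x y → x := x :+ y :+ y) refl x y ⟩
      x + y + y   ≡⟨ cong (_+ y) eq ⟩
      0# + y      ≡⟨ +-identityˡ y ⟩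
      y           ∎
      where open ≡-Reasoning

  x*x≡0⇒x≡0 : ∀ {x} → x * x ≡ 0# → x ≡ 0#
  x*x≡0⇒x≡0 eq with x*y≡0⇒x≡0∨y≡0 eq
  ... | inj₁ p = p
  ... | inj₂ p = p

  opaque
    -- Squaring is additive in characteristic 2 with trivial kernel, hence injective; on a finite
    -- field it is then surjective.
    sqrt : ∀ a → ∃ λ x → x * x ≡ a
    sqrt = injective⇒surjectiveᶠ λ {x} {y} x²≡y² → x+y≡0⇒x≡y (x*x≡0⇒x≡0 (begin
      (x + y) * (x + y) ≡⟨ solve 2 (λ x y → (x :+ y) :* (x :+ y) := x :* x :+ y :* y) refl x y ⟩
      x * x + y * y     ≡⟨ cong (_+ y * y) x²≡y² ⟩
      y * y + y * y     ≡⟨ x+x≡0 (y * y) ⟩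
      0#                ∎))
      where open ≡-Reasoning

  -- The Artin-Schreier map: a plane with `f e ≡ 1#` and `B e k ≡ 1#` has a nonzero singular vector
  -- exactly when `f k` is one of its values.
  ℘ : Carrier → Carrier
  ℘ x = x * x + x

  opaque
    ℘-+ : ∀ x y → ℘ (x + y) ≡ ℘ x + ℘ y
    ℘-+ = solve 2 (λ x y → (x :+ y) :* (x :+ y) :+ (x :+ y) := x :* x :+ x :+ (y :* y :+ y)) refl

  opaque
    ℘x≡0⇒x≡0∨x≡1 : ∀ {x} → ℘ x ≡ 0# → x ≡ 0# ⊎ x ≡ 1#
    ℘x≡0⇒x≡0∨x≡1 {x} eq
      with x*y≡0⇒x≡0∨y≡0 (trans (solve 1 (λ x → x :* (x :+ :1) := x :* x :+ x) refl x) eq)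
    ... | inj₁ x≡0   = inj₁ x≡0
    ... | inj₂ x+1≡0 = inj₂ (x+y≡0⇒x≡y x+1≡0)

    -- The kernel {0,1} of ℘ has order 2.  Sending x to ℘ x on one representative of each coset and
    -- to ℘ x + a on the other is injective when a is not a value of ℘, hence surjective.
  opaque
    image-℘-index-2 : ∀ {a} → (∀ s → ℘ s ≢ a) → ∀ b → ∃ λ s → ℘ s ≡ b ⊎ ℘ s ≡ b + a
    image-℘-index-2 {a} a∉℘ b = split (injective⇒surjectiveᶠ {g = g} (λ {x} {y} → g-injective x y) b)
      where
      open ≡-Reasoning
      -- In each coset of the kernel, the element with the smaller `index` is the representative
      -- satisfying `P`.
      P : Carrier → Set
      P x = index x < index (x + 1#)
      P? : ∀ x → Dec (P x)
      P? x = Fin._<?_ _ _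
      x+1+1 : ∀ x → x + 1# + 1# ≡ x
      x+1+1 = solve 1 (λ x → x :+ :1 :+ :1 := x) refl
      g′ : ∀ x → Dec (P x) → Carrier
      g′ x (yes _) = ℘ x
      g′ x (no _)  = ℘ x + a
      g : Carrier → Carrier
      g x = g′ x (P? x)
      P-x+1 : ∀ x y → x + y ≡ 1# → P x → ¬ P y
      P-x+1 x y x+y≡1 px py = ℕ.<-asym px
        (subst₂ (λ u v → index u < index v)
          (trans (solve 2 (λ x y → y := x :+ (x :+ y)) refl x y) (cong (x +_) x+y≡1))
          (trans (cong (y +_) (sym x+y≡1)) (solve 2 (λ x y → y :+ (x :+ y) := x) refl x y)) py)
      ¬P-x+1 : ∀ x y → x + y ≡ 1# → ¬ P x → P y
      ¬P-x+1 x y x+y≡1 ¬px = subst₂ (λ u v → index u < index v)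
          (sym y≡) (sym (trans (cong (_+ 1#) y≡) (x+1+1 x)))
          (ℕ.≤∧≢⇒< (ℕ.≮⇒≥ ¬px) λ eq → 0≢1 (trans (sym (x+x≡0 x))
            (trans (cong (x +_) (index-injective (Fin.toℕ-injective (sym eq))))
              (solve 1 (λ x → x :+ (x :+ :1) := :1) refl x))))
        where
        y≡ : y ≡ x + 1#
        y≡ = trans (solve 2 (λ x y → y := x :+ (x :+ y)) refl x y) (cong (x +_) x+y≡1)
      split : (∃ λ x → g x ≡ b) → ∃ λ s → ℘ s ≡ b ⊎ ℘ s ≡ b + a
      split (x , eq) = x , by (P? x) eq
        where
        by : ∀ d → g′ x d ≡ b → ℘ x ≡ b ⊎ ℘ x ≡ b + a
        by (yes _) eq = inj₁ eq
        by (no _)  eq = inj₂ (trans (solve 2 (λ u a → u := u :+ a :+ a) refl (℘ x) a) (cong (_+ a) eq))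
      ℘-kernel : ∀ {x y} → ℘ x + ℘ y ≡ 0# → ¬ (x + y ≡ 1#) → x ≡ y
      ℘-kernel {x} {y} eq ≢1 with ℘x≡0⇒x≡0∨x≡1 (trans (℘-+ x y) eq)
      ... | inj₁ p = x+y≡0⇒x≡y p
      ... | inj₂ p = contradiction p ≢1
      g-injective : ∀ x y → g x ≡ g y → x ≡ y
      g-injective x y = by (P? x) (P? y)
        where
        by : ∀ d e → g′ x d ≡ g′ y e → x ≡ y
        by (yes px) (yes py) eq = ℘-kernel (trans (cong (_+ ℘ y) eq) (x+x≡0 _)) λ p → P-x+1 x y p px py
        by (no ¬px) (no ¬py) eq = ℘-kernel
          (trans (solve 3 (λ x y a → x :+ y := (x :+ a) :+ (y :+ a)) refl (℘ x) (℘ y) a)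
            (trans (cong (_+ (℘ y + a)) eq) (x+x≡0 _)))
          λ p → ¬py (¬P-x+1 x y p ¬px)
        -- In the mixed cases, adding the two equal values gives `℘ (x + y) ≡ a`.
        by (yes px) (no ¬py) eq = contradiction (trans (℘-+ x y) (trans (cong (_+ ℘ y) eq)
          (solve 2 (λ y a → y :+ a :+ y := a) refl (℘ y) a))) (a∉℘ (x + y))
        by (no ¬px) (yes py) eq = contradiction (trans (℘-+ x y) (trans (cong (℘ x +_) (sym eq))
          (solve 2 (λ y a → y :+ (y :+ a) := a) refl (℘ x) a))) (a∉℘ (x + y))

-- Linear algebra over the field: bases, hyperplane sections and dimension.

module Linear {q : ℕ} (F : FiniteField q)
              (1+1≡0 : Characteristic2 F) (d : ℕ) where
  open FiniteField F
  open Char2 F 1+1≡0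
  open VectorSpace F d

  infix 4 _≟ᵛ_
  _≟ᵛ_ : DecidableEquality V
  _≟ᵛ_ = ≡-dec _≟_

  infixl 6 _⊕_
  infixr 7 _⊙_
  -- Syntax for reflecting linear identities: a term evaluates both to a vector and, coordinate by
  -- coordinate, to a scalar, so that an identity in `V` reduces to one for the ring solver.
  data Term (n : ℕ) : Set where
    ` : Fin n → Term n
    𝟘 : Term n
    _⊕_ : Term n → Term n → Term n
    _⊙_ : Carrier → Term n → Term n

  pattern 𝟎 = ` zero
  pattern 𝟏 = ` (suc zero)
  pattern 𝟐 = ` (suc (suc zero))

  ⟦_⟧ᵛ : ∀ {n} → Term n → Vec V n → V
  ⟦ ` i ⟧ᵛ ρ   = lookup ρ i
  ⟦ 𝟘 ⟧ᵛ ρ     = 0ᵛ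
  ⟦ s ⊕ t ⟧ᵛ ρ = ⟦ s ⟧ᵛ ρ +ᵛ ⟦ t ⟧ᵛ ρ
  ⟦ c ⊙ t ⟧ᵛ ρ = c • ⟦ t ⟧ᵛ ρ

  ⟦_⟧ : ∀ {n} → Term n → Vec Carrier n → Carrier
  ⟦ ` i ⟧ ρ   = lookup ρ i
  ⟦ 𝟘 ⟧ ρ     = 0#
  ⟦ s ⊕ t ⟧ ρ = ⟦ s ⟧ ρ + ⟦ t ⟧ ρ
  ⟦ c ⊙ t ⟧ ρ = c * ⟦ t ⟧ ρ

  opaque
    lookup-⟦⟧ : ∀ {n} (t : Term n) ρ i → lookup (⟦ t ⟧ᵛ ρ) i ≡ ⟦ t ⟧ (map (λ v → lookup v i) ρ)
    lookup-⟦⟧ (` j) ρ i = sym (lookup-map j (λ v → lookup v i) ρ)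
    lookup-⟦⟧ 𝟘 ρ i = lookup-replicate i 0#
    lookup-⟦⟧ (s ⊕ t) ρ i = trans (lookup-zipWith _+_ i (⟦ s ⟧ᵛ ρ) (⟦ t ⟧ᵛ ρ))
                              (cong₂ _+_ (lookup-⟦⟧ s ρ i) (lookup-⟦⟧ t ρ i))
    lookup-⟦⟧ (c ⊙ t) ρ i = trans (lookup-map i (c *_) (⟦ t ⟧ᵛ ρ)) (cong (c *_) (lookup-⟦⟧ t ρ i))

    lookup-injective : ∀ {u v : V} → (∀ i → lookup u i ≡ lookup v i) → u ≡ v
    lookup-injective eq = Pointwise-≡⇒≡ (ext eq)

    coordinatewise : ∀ {n} (s t : Term n) → (∀ ρ → ⟦ s ⟧ ρ ≡ ⟦ t ⟧ ρ) → ∀ ρ → ⟦ s ⟧ᵛ ρ ≡ ⟦ t ⟧ᵛ ρ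
    coordinatewise s t eq ρ = lookup-injective λ i →
      trans (lookup-⟦⟧ s ρ i) (trans (eq _) (sym (lookup-⟦⟧ t ρ i)))

  record IsLinear (g : V → Carrier) : Set where
    field
      +-homo : ∀ u v → g (u +ᵛ v) ≡ g u + g v
      •-homo : ∀ c v → g (c • v) ≡ c * g v

    +•-homo : ∀ u c v → g (u +ᵛ c • v) ≡ g u + c * g v
    +•-homo u c v = trans (+-homo u (c • v)) (cong (g u +_) (•-homo c v))

    0-homo : g 0ᵛ ≡ 0#
    0-homo = begin
      g 0ᵛ        ≡⟨ cong g (coordinatewise 𝟘 (0# ⊙ 𝟘) (λ _ → sym (zeroˡ 0#)) []) ⟩
      g (0# • 0ᵛ) ≡⟨ •-homo 0# 0ᵛ ⟩
      0# * g 0ᵛ   ≡⟨ zeroˡ _ ⟩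
      0#          ∎
      where open ≡-Reasoning

  lookup-isLinear : ∀ i → IsLinear (λ v → lookup v i)
  lookup-isLinear i = record
    { +-homo = λ u v → lookup-zipWith _+_ i u v
    ; •-homo = λ c v → lookup-map i (c *_) v
    }

  kernel : Subspace → {g : V → Carrier} → IsLinear g → Subspace
  kernel W {g} lin = record
    { ∣_∣      = λ v → v ∈ ∣ W ∣ × g v ≡ 0#
    ; 0-closed = 0-closed W , 0-homo
    ; +-closed = λ {u} {v} (u∈W , gu≡0) (v∈W , gv≡0) → +-closed W u∈W v∈W ,
                   trans (+-homo u v) (trans (cong₂ _+_ gu≡0 gv≡0) (+-identityˡ 0#))
    ; •-closed = λ c {v} (v∈W , gv≡0) → •-closed W c v∈W ,
                   trans (•-homo c v) (trans (cong (c *_) gv≡0) (zeroʳ c))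
    }
    where open IsLinear lin

  opaque
    0•v≡0 : ∀ v → 0# • v ≡ 0ᵛ
    0•v≡0 v = coordinatewise (0# ⊙ 𝟎) 𝟘 (λ { (x ∷ []) → zeroˡ x }) (v ∷ [])

    0•v+u≡u : ∀ v u → 0# • v +ᵛ u ≡ u
    0•v+u≡u v u = coordinatewise (0# ⊙ 𝟎 ⊕ 𝟏) 𝟏
      (λ { (x ∷ y ∷ []) → solve 2 (λ x y → :0 :* x :+ y := y) refl x y }) (v ∷ u ∷ [])

    u+0•v≡u : ∀ u v → u +ᵛ 0# • v ≡ u
    u+0•v≡u u v = coordinatewise (𝟎 ⊕ 0# ⊙ 𝟏) 𝟎
      (λ { (x ∷ y ∷ []) → solve 2 (λ x y → x :+ :0 :* y := x) refl x y }) (u ∷ v ∷ [])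

    +ᵛ-identityˡ : ∀ v → 0ᵛ +ᵛ v ≡ v
    +ᵛ-identityˡ v = coordinatewise (𝟘 ⊕ 𝟎) 𝟎 (λ { (x ∷ []) → +-identityˡ x }) (v ∷ [])

    +ᵛ-identityʳ : ∀ v → v +ᵛ 0ᵛ ≡ v
    +ᵛ-identityʳ v = coordinatewise (𝟎 ⊕ 𝟘) 𝟎 (λ { (x ∷ []) → +-identityʳ x }) (v ∷ [])

    +ᵛ-comm : ∀ u v → u +ᵛ v ≡ v +ᵛ u
    +ᵛ-comm u v = coordinatewise (𝟎 ⊕ 𝟏) (𝟏 ⊕ 𝟎) (λ { (x ∷ y ∷ []) → +-comm x y }) (u ∷ v ∷ [])

    •-zeroʳ : ∀ c → c • 0ᵛ ≡ 0ᵛ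
    •-zeroʳ c = coordinatewise (c ⊙ 𝟘) 𝟘 (λ _ → zeroʳ c) []

    v+v≡0 : ∀ v → v +ᵛ v ≡ 0ᵛ
    v+v≡0 v = coordinatewise (𝟎 ⊕ 𝟎) 𝟘 (λ { (x ∷ []) → x+x≡0 x }) (v ∷ [])

    u+v+v≡u : ∀ u v → u +ᵛ v +ᵛ v ≡ u
    u+v+v≡u u v = coordinatewise (𝟎 ⊕ 𝟏 ⊕ 𝟏) 𝟎
      (λ { (x ∷ y ∷ []) → solve 2 (λ x y → x :+ y :+ y := x) refl x y }) (u ∷ v ∷ [])

    u+v≡0⇒u≡v : ∀ {u v} → u +ᵛ v ≡ 0ᵛ → u ≡ v
    u+v≡0⇒u≡v {u} {v} eq = trans (sym (u+v+v≡u u v)) (trans (cong (_+ᵛ v) eq) (+ᵛ-identityˡ v))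

    •-•-inverse : ∀ c c⁻¹ v → c * c⁻¹ ≡ 1# → c⁻¹ • c • v ≡ v
    •-•-inverse c c⁻¹ v eq = coordinatewise (c⁻¹ ⊙ c ⊙ 𝟎) 𝟎 (λ { (x ∷ []) → begin
      c⁻¹ * (c * x) ≡⟨ solve 3 (λ c b x → b :* (c :* x) := c :* b :* x) refl c c⁻¹ x ⟩
      c * c⁻¹ * x   ≡⟨ cong (_* x) eq ⟩
      1# * x        ≡⟨ *-identityˡ x ⟩
      x             ∎ }) (v ∷ [])
      where open ≡-Reasoning

  module _ (W : Subspace) where
    +-cancelʳ-∈ : ∀ {u v} → u +ᵛ v ∈ ∣ W ∣ → v ∈ ∣ W ∣ → u ∈ ∣ W ∣
    +-cancelʳ-∈ {u} {v} u+v∈W v∈W = subst (_∈ ∣ W ∣) (u+v+v≡u u v) (+-closed W u+v∈W v∈W)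

    •-cancel-∈ : ∀ {c v} → c ≢ 0# → c • v ∈ ∣ W ∣ → v ∈ ∣ W ∣
    •-cancel-∈ {c} {v} c≢0 cv∈W with c⁻¹ , eq ← inverse c c≢0 =
      subst (_∈ ∣ W ∣) (•-•-inverse c c⁻¹ v eq) (•-closed W c⁻¹ cv∈W)

    lincomb-∈ : ∀ {k} (c : F.Vector Carrier k) {b} → (∀ i → b i ∈ ∣ W ∣) → lincomb c b ∈ ∣ W ∣
    lincomb-∈ {zero}  c b∈W = 0-closed W
    lincomb-∈ {suc k} c b∈W = +-closed W (•-closed W (c zero) (b∈W zero)) (lincomb-∈ (c ∘ suc) (b∈W ∘ suc))

  opaque
    c•v≡0⇒c≡0 : ∀ {c v} → v ≢ 0ᵛ → c • v ≡ 0ᵛ → c ≡ 0#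
    c•v≡0⇒c≡0 {c} {v} v≢0 cv≡0 with c ≟ 0#
    ... | yes c≡0 = c≡0
    ... | no  c≢0 with c⁻¹ , eq ← inverse c c≢0 = contradiction
      (trans (sym (•-•-inverse c c⁻¹ v eq)) (trans (cong (c⁻¹ •_) cv≡0) (•-zeroʳ c⁻¹))) v≢0

  opaque
    lincomb-+ : ∀ {k} (c e : F.Vector Carrier k) b →
                lincomb (λ i → c i + e i) b ≡ lincomb c b +ᵛ lincomb e b
    lincomb-+ {zero}  c e b = sym (+ᵛ-identityˡ 0ᵛ)
    lincomb-+ {suc k} c e b = trans
      (cong ((c zero + e zero) • b zero +ᵛ_) (lincomb-+ (c ∘ suc) (e ∘ suc) (b ∘ suc)))
      (coordinatewise ((c zero + e zero) ⊙ 𝟎 ⊕ (𝟏 ⊕ 𝟐)) ((c zero ⊙ 𝟎 ⊕ 𝟏) ⊕ (e zero ⊙ 𝟎 ⊕ 𝟐))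
        (λ { (x ∷ y ∷ z ∷ []) → solve 5 (λ c e x y z → (c :+ e) :* x :+ (y :+ z) :=
                                  (c :* x :+ y) :+ (e :* x :+ z)) refl (c zero) (e zero) x y z })
        (_ ∷ _ ∷ _ ∷ []))

    lincomb-• : ∀ {k} a (c : F.Vector Carrier k) b → lincomb (λ i → a * c i) b ≡ a • lincomb c b
    lincomb-• {zero}  a c b = sym (•-zeroʳ a)
    lincomb-• {suc k} a c b = trans
      (cong ((a * c zero) • b zero +ᵛ_) (lincomb-• a (c ∘ suc) (b ∘ suc)))
      (coordinatewise ((a * c zero) ⊙ 𝟎 ⊕ a ⊙ 𝟏) (a ⊙ (c zero ⊙ 𝟎 ⊕ 𝟏))
        (λ { (x ∷ y ∷ []) → solve 4 (λ a c x y → a :* c :* x :+ a :* y := a :* (c :* x :+ y)) refl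
                              a (c zero) x y })
        (_ ∷ _ ∷ []))

    lincomb-0 : ∀ {k} (b : F.Vector V k) → lincomb (λ _ → 0#) b ≡ 0ᵛ
    lincomb-0 {zero}  b = refl
    lincomb-0 {suc k} b = trans (0•v+u≡u (b zero) _) (lincomb-0 (b ∘ suc))

  opaque
    lincomb-shift : ∀ {k} (c a : F.Vector Carrier k) b v →
                    ∃ λ s → lincomb c (λ i → b i +ᵛ a i • v) ≡ lincomb c b +ᵛ s • v
    lincomb-shift {zero}  c a b v = 0# , sym (u+0•v≡u 0ᵛ v)
    lincomb-shift {suc k} c a b v with s , eq ← lincomb-shift (c ∘ suc) (a ∘ suc) (b ∘ suc) v =
      c zero * a zero + s , trans (cong (c zero • (b zero +ᵛ a zero • v) +ᵛ_) eq)
        (coordinatewise (c zero ⊙ (𝟎 ⊕ a zero ⊙ 𝟏) ⊕ (𝟐 ⊕ s ⊙ 𝟏))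
                        ((c zero ⊙ 𝟎 ⊕ 𝟐) ⊕ (c zero * a zero + s) ⊙ 𝟏)
          (λ { (x ∷ y ∷ z ∷ []) → solve 6 (λ c a s x y z →
               c :* (x :+ a :* y) :+ (z :+ s :* y) := (c :* x :+ z) :+ (c :* a :+ s) :* y) refl
               (c zero) (a zero) s x y z })
          (_ ∷ _ ∷ _ ∷ []))

  spanned : ∀ {k} → F.Vector V k → Subspace
  spanned b = record
    { ∣_∣      = Span b
    ; 0-closed = (λ _ → 0#) , sym (lincomb-0 b)
    ; +-closed = λ (c , u≡) (e , v≡) → (λ i → c i + e i) , trans (cong₂ _+ᵛ_ u≡ v≡) (sym (lincomb-+ c e b))
    ; •-closed = λ a (c , v≡) → (λ i → a * c i) , trans (cong (a •_) v≡) (sym (lincomb-• a c b))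
    }

  -- The sum of `⟨v⟩` and `W`. Since addition is subtraction here, `u +ᵛ c • v ∈ ∣ W ∣` says that
  -- `u` differs from `c • v` by a vector of `W`.
  adjoin : V → Subspace → Subspace
  adjoin v W = record
    { ∣_∣      = λ u → ∃ λ c → u +ᵛ c • v ∈ ∣ W ∣
    ; 0-closed = 0# , subst (_∈ ∣ W ∣) (sym (u+0•v≡u 0ᵛ v)) (0-closed W)
    ; +-closed = λ {u} {w} (c , p) (e , r) → c + e , subst (_∈ ∣ W ∣)
        (coordinatewise (𝟎 ⊕ c ⊙ 𝟐 ⊕ (𝟏 ⊕ e ⊙ 𝟐)) (𝟎 ⊕ 𝟏 ⊕ (c + e) ⊙ 𝟐)
          (λ { (x ∷ y ∷ z ∷ []) → solve 5 (λ c e x y z → x :+ c :* z :+ (y :+ e :* z) :=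
                x :+ y :+ (c :+ e) :* z) refl c e x y z })
          (u ∷ w ∷ v ∷ []))
        (+-closed W p r)
    ; •-closed = λ a {u} (c , p) → a * c , subst (_∈ ∣ W ∣)
        (coordinatewise (a ⊙ (𝟎 ⊕ c ⊙ 𝟏)) (a ⊙ 𝟎 ⊕ (a * c) ⊙ 𝟏)
          (λ { (x ∷ y ∷ []) → solve 4 (λ a c x y → a :* (x :+ c :* y) := a :* x :+ a :* c :* y) refl
                a c x y })
          (u ∷ v ∷ []))
        (•-closed W a p)
    }

  module _ (v : V) (W : Subspace) where
    ∈-adjoin : v ∈ ∣ adjoin v W ∣
    ∈-adjoin = 1# , subst (_∈ ∣ W ∣) (sym (trans (cong (v +ᵛ_) (•-identityˡ v)) (v+v≡0 v))) (0-closed W)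

    ⊆-adjoin : ∣ W ∣ ⊆ ∣ adjoin v W ∣
    ⊆-adjoin {w} w∈W = 0# , subst (_∈ ∣ W ∣)
      (sym (u+0•v≡u w v)) w∈W

    adjoin-⊆ : (U : Subspace) → v ∈ ∣ U ∣ → ∣ W ∣ ⊆ ∣ U ∣ → ∣ adjoin v W ∣ ⊆ ∣ U ∣
    adjoin-⊆ U v∈U W⊆U (c , p) = +-cancelʳ-∈ U (W⊆U p) (•-closed U c v∈U)

  HasDim-≐ : ∀ {W W′ k} → ∣ W ∣ ≐ ∣ W′ ∣ → HasDim W k → HasDim W′ k
  HasDim-≐ (W⊆W′ , W′⊆W) (b , ind , W⊆ , ⊆W) = b , ind , (λ p → W⊆ (W′⊆W p)) , (λ p → W⊆W′ (⊆W p))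

  opaque
    HasDim-adjoin : ∀ {v W k} → v ∉ ∣ W ∣ → HasDim W k → HasDim (adjoin v W) (suc k)
    HasDim-adjoin {v} {W} {k} v∉W (b , ind , W⊆ , ⊆W) = b′ , ind′ , (λ {u} → to {u}) , from
      where
      b′ : F.Vector V (suc k)
      b′ = v F.∷ b
      c₀≡0 : ∀ c → lincomb c b′ ≡ 0ᵛ → c zero ≡ 0#
      c₀≡0 c eq with c zero ≟ 0#
      ... | yes p = p
      ... | no  p = contradiction (•-cancel-∈ W p (subst (_∈ ∣ W ∣) (sym (u+v≡0⇒u≡v eq)) (⊆W (c ∘ suc , refl)))) v∉W
      ind′ : LinearlyIndependent b′
      ind′ c eq zero    = c₀≡0 c eq
      ind′ c eq (suc i) = ind (c ∘ suc) (begin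
        lincomb (c ∘ suc) b                ≡⟨ 0•v+u≡u v _ ⟨
        0# • v +ᵛ lincomb (c ∘ suc) b      ≡⟨ cong (λ a → a • v +ᵛ lincomb (c ∘ suc) b) (c₀≡0 c eq) ⟨
        c zero • v +ᵛ lincomb (c ∘ suc) b  ≡⟨ eq ⟩
        0ᵛ                                 ∎) i
        where open ≡-Reasoning
      to : ∣ adjoin v W ∣ ⊆ Span b′
      to {u} (c , p) with e , eq ← W⊆ p = c F.∷ e , trans (sym (u+v+v≡u u (c • v)))
        (trans (cong (_+ᵛ c • v) eq) (+ᵛ-comm _ _))
      from : Span b′ ⊆ ∣ adjoin v W ∣
      from {u} (c , eq) = c zero , subst (_∈ ∣ W ∣)
        (trans (sym (u+v+v≡u _ _)) (cong (_+ᵛ c zero • v) (trans (+ᵛ-comm _ _) (sym eq))))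
        (⊆W (c ∘ suc , refl))

  zeroSubspace : Subspace
  zeroSubspace = spanned {0} (λ ())

  HasDim-zero : HasDim zeroSubspace 0
  HasDim-zero = (λ ()) , (λ _ _ ()) , (λ p → p) , (λ p → p)

  v∉0 : ∀ {v} → v ≢ 0ᵛ → v ∉ ∣ zeroSubspace ∣
  v∉0 v≢0 (_ , v≡0) = v≢0 v≡0

  -- The form in which a basis is taken apart in an induction on the dimension: one vector and a
  -- complement to it.
  record Decomposition (W : Subspace) (k : ℕ) : Set₁ where
    field
      v           : V
      W′          : Subspace
      v∉W′        : v ∉ ∣ W′ ∣
      W′-dim      : HasDim W′ k
      W≐adjoin    : ∣ W ∣ ≐ ∣ adjoin v W′ ∣

    v∈W : v ∈ ∣ W ∣
    v∈W = proj₂ W≐adjoin (∈-adjoin v W′)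

    W′⊆W : ∣ W′ ∣ ⊆ ∣ W ∣
    W′⊆W p = proj₂ W≐adjoin (⊆-adjoin v W′ p)

    v≢0 : v ≢ 0ᵛ
    v≢0 v≡0 = v∉W′ (subst (_∈ ∣ W′ ∣) (sym v≡0) (0-closed W′))

  decompose : ∀ {W k} → HasDim W (suc k) → Decomposition W k
  decompose {W} {k} (b , ind , W⊆ , ⊆W) = record
    { v        = b zero
    ; W′       = spanned (b ∘ suc)
    ; v∉W′     = λ (c , eq) → 0≢1 (sym (ind (1# F.∷ c)
        (trans (cong₂ _+ᵛ_ (trans (•-identityˡ (b zero)) eq) refl) (v+v≡0 _)) zero))
    ; W′-dim   = b ∘ suc , (λ c eq i → ind (0# F.∷ c)
        (trans (0•v+u≡u (b zero) _) eq) (suc i))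
        , (λ p → p) , (λ p → p)
    ; W≐adjoin = to , λ (c , e , eq) → ⊆W (c F.∷ e , trans (sym (u+v+v≡u _ (c • b zero)))
        (trans (cong (_+ᵛ c • b zero) eq) (+ᵛ-comm _ _)))
    }
    where
    to : ∣ W ∣ ⊆ ∣ adjoin (b zero) (spanned (b ∘ suc)) ∣
    to {u} p with c , eq ← W⊆ p = c zero , c ∘ suc ,
      trans (cong (_+ᵛ c zero • b zero) (trans eq (+ᵛ-comm _ _))) (u+v+v≡u _ _)

  opaque
    HasDim-nonzero : ∀ {W k} → HasDim W (suc k) → ∃ λ v → v ∈ ∣ W ∣ × v ≢ 0ᵛ
    HasDim-nonzero {W} {k} W-dim = v , v∈W , v≢0
      where open Decomposition (decompose {W} {k} W-dim)

  module _ {g} (lin : IsLinear g) where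
    open IsLinear lin
    open ≡-Reasoning

    opaque
      -- The coefficient is `g w` divided by `g v`; the sign disappears in characteristic 2.
      kernel-projection : ∀ {v} → g v ≢ 0# → ∀ w → ∃ λ c → g (w +ᵛ c • v) ≡ 0#
      kernel-projection {v} gv≢0 w with a , eq ← inverse (g v) gv≢0 = g w * a , (begin
        g (w +ᵛ (g w * a) • v)     ≡⟨ +•-homo w (g w * a) v ⟩
        g w + g w * a * g v        ≡⟨ solve 3 (λ x b y → x :+ x :* b :* y := x :+ x :* (y :* b)) refl (g w) a (g v) ⟩
        g w + g w * (g v * a)      ≡⟨ cong (λ z → g w + g w * z) eq ⟩
        g w + g w * 1#             ≡⟨ solve 1 (λ x → x :+ x :* :1 := :0) refl (g w) ⟩
        0#                         ∎)

      +•-kernel : ∀ {u v} → g u ≡ 0# → g v ≡ 0# → ∀ c → g (u +ᵛ c • v) ≡ 0#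
      +•-kernel {u} {v} gu≡0 gv≡0 c = begin
        g (u +ᵛ c • v)   ≡⟨ +•-homo u c v ⟩
        g u + c * g v    ≡⟨ cong₂ (λ x y → x + c * y) gu≡0 gv≡0 ⟩
        0# + c * 0#      ≡⟨ solve 1 (λ x → :0 :+ x :* :0 := :0) refl c ⟩
        0#               ∎

      +•-kernel-coefficient : ∀ {u v c} → g u ≡ 0# → g v ≢ 0# → g (u +ᵛ c • v) ≡ 0# → c ≡ 0#
      +•-kernel-coefficient {u} {v} {c} gu≡0 gv≢0 eq = by (x*y≡0⇒x≡0∨y≡0 (begin
        c * g v          ≡⟨ +-identityˡ _ ⟨
        0# + c * g v     ≡⟨ cong (_+ c * g v) gu≡0 ⟨
        g u + c * g v    ≡⟨ +•-homo u c v ⟨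
        g (u +ᵛ c • v)   ≡⟨ eq ⟩
        0#               ∎))
        where
        by : c ≡ 0# ⊎ g v ≡ 0# → c ≡ 0#
        by (inj₁ p) = p
        by (inj₂ p) = contradiction p gv≢0

      lincomb-kernel : ∀ {k} (c : F.Vector Carrier k) {b} → (∀ i → g (b i) ≡ 0#) → g (lincomb c b) ≡ 0#
      lincomb-kernel {zero}  c gb≡0 = 0-homo
      lincomb-kernel {suc k} c {b} gb≡0 = begin
        g (c zero • b zero +ᵛ lincomb (c ∘ suc) (b ∘ suc))     ≡⟨ +-homo _ _ ⟩
        g (c zero • b zero) + g (lincomb (c ∘ suc) (b ∘ suc))  ≡⟨ cong₂ _+_ (•-homo _ _) (lincomb-kernel (c ∘ suc) (gb≡0 ∘ suc)) ⟩
        c zero * g (b zero) + 0#                               ≡⟨ cong (λ z → c zero * z + 0#) (gb≡0 zero) ⟩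
        c zero * 0# + 0#                                       ≡⟨ solve 1 (λ x → x :* :0 :+ :0 := :0) refl (c zero) ⟩
        0#                                                     ∎

  opaque
    basis-∈ : ∀ {P : V → Set} {k} (b : F.Vector V k) → Span b ⊆ P → ∀ i → P (b i)
    basis-∈ {k = suc k} b ⊆W zero    = ⊆W (1# F.∷ (λ _ → 0#) ,
      sym (trans (cong₂ _+ᵛ_ (•-identityˡ _) (lincomb-0 (b ∘ suc))) (+ᵛ-identityʳ _)))
    basis-∈ {k = suc k} b ⊆W (suc i) = basis-∈ (b ∘ suc) (λ (c , eq) → ⊆W (0# F.∷ c ,
      trans eq (sym (0•v+u≡u (b zero) _)))) i

  opaque
    -- The remaining basis vectors, corrected by multiples of the first so as to lie in the kernel,
    -- form a basis of it.
    HasDim-kernel-head : ∀ {W k g} (lin : IsLinear g) (W-dim : HasDim W (suc k)) →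
                         g (proj₁ W-dim zero) ≢ 0# → HasDim (kernel W lin) k
    HasDim-kernel-head {W} {k} {g} lin (b , ind , W⊆ , ⊆W) gb₀≢0 = b′ , ind′ , to , from
      where
      b₀ : V
      b₀ = b zero
      a : F.Vector Carrier k
      a i = proj₁ (kernel-projection lin gb₀≢0 (b (suc i)))
      b′ : F.Vector V k
      b′ i = b (suc i) +ᵛ a i • b₀
      shift : ∀ c → ∃ λ s → lincomb c b′ ≡ lincomb c (b ∘ suc) +ᵛ s • b₀
      shift c = lincomb-shift c a (b ∘ suc) b₀
      ind′ : LinearlyIndependent b′
      -- A relation among the corrected vectors is one among the old ones, with an extra coefficient
      -- `s` at `b₀`.
      ind′ c eq i with s , eq′ ← shift c = ind (s F.∷ c) (trans (+ᵛ-comm (s • b₀) _) (trans (sym eq′) eq)) (suc i)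
      b′∈ : ∀ i → b′ i ∈ ∣ kernel W lin ∣
      b′∈ i = +-closed W (basis-∈ {∣ W ∣} b ⊆W (suc i)) (•-closed W (a i) (basis-∈ {∣ W ∣} b ⊆W zero))
            , proj₂ (kernel-projection lin gb₀≢0 (b (suc i)))
      shift′ : ∀ c → ∃ λ s → lincomb c b ≡ lincomb (c ∘ suc) b′ +ᵛ s • b₀
      shift′ c with s , eq ← shift (c ∘ suc) = c zero + s , trans
          (coordinatewise (c zero ⊙ 𝟎 ⊕ 𝟏) (𝟏 ⊕ s ⊙ 𝟎 ⊕ (c zero + s) ⊙ 𝟎)
            (λ { (x ∷ y ∷ []) → solve 4 (λ c s x y → c :* x :+ y := y :+ s :* x :+ (c :+ s) :* x) refl
                 (c zero) s x y }) (b₀ ∷ lincomb (c ∘ suc) (b ∘ suc) ∷ []))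
          (cong (_+ᵛ (c zero + s) • b₀) (sym eq))
      to : ∣ kernel W lin ∣ ⊆ Span b′
      -- The coefficient at `b₀` vanishes because `g` vanishes on `u` and on the corrected vectors
      -- but not on `b₀`.
      to {u} (u∈W , gu≡0) with c , eq ← W⊆ u∈W with s , eq′ ← shift′ c = c ∘ suc ,
        trans eq (trans eq′ (trans (cong (λ z → lincomb (c ∘ suc) b′ +ᵛ z • b₀)
          (+•-kernel-coefficient lin (lincomb-kernel lin (c ∘ suc) (proj₂ ∘ b′∈)) gb₀≢0
            (trans (cong g (sym (trans eq eq′))) gu≡0)))
          (u+0•v≡u _ b₀)))
      from : Span b′ ⊆ ∣ kernel W lin ∣
      from (c , eq) = subst (_∈ ∣ kernel W lin ∣) (sym eq) (lincomb-∈ (kernel W lin) c b′∈)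

  opaque
    -- Gaussian elimination with a pivot search: basis vectors on which `g` vanishes are set aside
    -- and adjoined to the kernel afterwards, until `HasDim-kernel-head` applies.
    HasDim-kernel : ∀ {W k g} (lin : IsLinear g) → HasDim W (suc k) →
                    ∀ {w} → w ∈ ∣ W ∣ → g w ≢ 0# → HasDim (kernel W lin) k
    HasDim-kernel-tail : ∀ {W k g} (lin : IsLinear g) → (D : Decomposition W k) → g (Decomposition.v D) ≡ 0# →
                         ∀ {w} → w ∈ ∣ W ∣ → g w ≢ 0# → HasDim (kernel W lin) k

    HasDim-kernel {W} {g = g} lin W-dim {w} w∈W gw≢0 with g (proj₁ W-dim zero) ≟ 0#
    ... | no gb₀≢0  = HasDim-kernel-head {W} lin W-dim gb₀≢0
    ... | yes gb₀≡0 = HasDim-kernel-tail {W} lin (decompose {W} W-dim) gb₀≡0 {w} w∈W gw≢0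

    HasDim-kernel-tail {W} {k} {g} lin D gv≡0 {w} w∈W gw≢0 = by W′-dim
      where
      open Decomposition D
      c : Carrier
      c = proj₁ (proj₁ W≐adjoin w∈W)
      w′∈W′ : w +ᵛ c • v ∈ ∣ W′ ∣
      w′∈W′ = proj₂ (proj₁ W≐adjoin w∈W)
      gw′≢0 : g (w +ᵛ c • v) ≢ 0#
      gw′≢0 eq = gw≢0 (trans (cong g (sym (u+v+v≡u w (c • v)))) (+•-kernel lin eq gv≡0 c))
      to : ∣ adjoin v (kernel W′ lin) ∣ ⊆ ∣ kernel W lin ∣
      to = adjoin-⊆ v (kernel W′ lin) (kernel W lin) (v∈W , gv≡0) λ (p , r) → W′⊆W p , r
      from : ∣ kernel W lin ∣ ⊆ ∣ adjoin v (kernel W′ lin) ∣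
      from (u∈W , gu≡0) with c , p ← proj₁ W≐adjoin u∈W = c , p , +•-kernel lin gu≡0 gv≡0 c
      by : ∀ {k} → HasDim W′ k → HasDim (kernel W lin) k
      -- A zero `W′` cannot contain `w +ᵛ c • v`, on which `g` is nonzero.
      by {zero} (_ , _ , W′⊆ , _) = contradiction (trans (cong g (proj₂ (W′⊆ w′∈W′))) (IsLinear.0-homo lin)) gw′≢0
      by {suc k} W′-dim = HasDim-≐ {adjoin v (kernel W′ lin)} {kernel W lin} (to , from)
        (HasDim-adjoin {v} {kernel W′ lin} (v∉W′ ∘ proj₁) (HasDim-kernel {W′} lin W′-dim w′∈W′ gw′≢0))

  opaque
    nonzero-coordinate : ∀ {v} → v ≢ 0ᵛ → ∃ λ i → lookup v i ≢ 0#
    nonzero-coordinate {v} v≢0 with Fin.any? (λ i → ¬? (lookup v i ≟ 0#))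
    ... | yes p = p
    ... | no ¬p = contradiction (lookup-injective λ i → trans (zero-at i) (sym (lookup-replicate i 0#))) v≢0
      where
      zero-at : ∀ i → lookup v i ≡ 0#
      zero-at i = decidable-stable (lookup v i ≟ 0#) λ ¬q → ¬p (i , ¬q)

  -- The data for an induction on the dimension: a subspace containing `v` is determined by its
  -- intersection with the kernel of `g`, and `project` moves membership questions there along `v`.
  record Cut (W : Subspace) : Set where
    field
      {g}   : V → Carrier
      lin   : IsLinear g
      v     : V
      v∈W   : v ∈ ∣ W ∣
      gv≢0  : g v ≢ 0#

    project : V → V
    project u = u +ᵛ proj₁ (kernel-projection lin gv≢0 u) • v

    module _ (W′ : Subspace) (v∈W′ : v ∈ ∣ W′ ∣) where
      project-∈ : ∀ {u} → u ∈ ∣ W′ ∣ → project u ∈ ∣ kernel W′ lin ∣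
      project-∈ {u} u∈W′ = +-closed W′ u∈W′ (•-closed W′ _ v∈W′) , proj₂ (kernel-projection lin gv≢0 u)

      project-∈⁻¹ : ∀ {u} → project u ∈ ∣ kernel W′ lin ∣ → u ∈ ∣ W′ ∣
      project-∈⁻¹ (p , _) = +-cancelʳ-∈ W′ p (•-closed W′ _ v∈W′)

  opaque
    cut : ∀ {W k} → HasDim W (suc k) → Cut W
    cut {W} W-dim with v , v∈W , v≢0 ← HasDim-nonzero {W} W-dim
      with i , vᵢ≢0 ← nonzero-coordinate v≢0
      = record { lin = lookup-isLinear i ; v = v ; v∈W = v∈W ; gv≢0 = vᵢ≢0 }

  opaque
    -- Both subspaces are cut by the same functional, chosen nonzero on a vector of `W`, until both
    -- have dimension 0.
    ⊆∧dim⇒⊇ : ∀ {W W′ k} → HasDim W k → HasDim W′ k → ∣ W ∣ ⊆ ∣ W′ ∣ → ∣ W′ ∣ ⊆ ∣ W ∣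
    ⊆∧dim⇒⊇ {W} {W′} {zero} _ (_ , _ , W′⊆ , _) _ u∈W′ =
      subst (_∈ ∣ W ∣) (sym (proj₂ (W′⊆ u∈W′))) (0-closed W)
    ⊆∧dim⇒⊇ {W} {W′} {suc k} W-dim W′-dim W⊆W′ u∈W′ = project-∈⁻¹ W v∈W
      (⊆∧dim⇒⊇ {kernel W lin} {kernel W′ lin} {k}
        (HasDim-kernel {W} lin W-dim v∈W gv≢0) (HasDim-kernel {W′} lin W′-dim (W⊆W′ v∈W) gv≢0)
        (λ (p , r) → W⊆W′ p , r) (project-∈ W′ (W⊆W′ v∈W) u∈W′))
      where open Cut (cut {W} W-dim)

  opaque
    ∈? : ∀ {W k} → HasDim W k → Decidable ∣ W ∣
    ∈? {W} {zero} (_ , _ , W⊆ , _) u = map′ (λ u≡0 → subst (_∈ ∣ W ∣) (sym u≡0) (0-closed W))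
      (λ u∈W → proj₂ (W⊆ u∈W)) (u ≟ᵛ 0ᵛ)
    ∈? {W} {suc k} W-dim u = map′ (project-∈⁻¹ W v∈W) (project-∈ W v∈W)
      (∈? {kernel W lin} {k} (HasDim-kernel {W} lin W-dim v∈W gv≢0) (project u))
      where open Cut (cut {W} W-dim)

  opaque
    vanishes? : ∀ {W k g} (lin : IsLinear g) → HasDim W k →
                (∃ λ w → w ∈ ∣ W ∣ × g w ≢ 0#) ⊎ (∀ {w} → w ∈ ∣ W ∣ → g w ≡ 0#)
    vanishes? {W} {g = g} lin (b , _ , W⊆ , ⊆W) with Fin.any? (λ i → ¬? (g (b i) ≟ 0#))
    ... | yes (i , gbᵢ≢0) = inj₁ (b i , basis-∈ {∣ W ∣} b ⊆W i , gbᵢ≢0)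
    ... | no ¬p = inj₂ λ w∈W → trans (cong g (proj₂ (W⊆ w∈W))) (lincomb-kernel lin (proj₁ (W⊆ w∈W))
      λ i → decidable-stable (g (b i) ≟ 0#) λ gbᵢ≢0 → ¬p (i , gbᵢ≢0))

  opaque
    nonzero-in-kernel : ∀ {W k g} (lin : IsLinear g) → HasDim W (2 ℕ.+ k) →
                        ∃ λ v → v ∈ ∣ kernel W lin ∣ × v ≢ 0ᵛ
    nonzero-in-kernel {W} {k} {g} lin W-dim = by (vanishes? {W} lin W-dim)
      where
      by : (∃ λ w → w ∈ ∣ W ∣ × g w ≢ 0#) ⊎ (∀ {w} → w ∈ ∣ W ∣ → g w ≡ 0#) → ∃ λ v → v ∈ ∣ kernel W lin ∣ × v ≢ 0ᵛ
      by (inj₁ (w , w∈W , gw≢0)) =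
        HasDim-nonzero {kernel W lin} (HasDim-kernel {W} {suc k} lin W-dim w∈W gw≢0)
      by (inj₂ gW≡0) with v , v∈W , v≢0 ← HasDim-nonzero {W} W-dim = v , (v∈W , gW≡0 v∈W) , v≢0

  unit : Fin d → V
  unit i = 0ᵛ [ i ]≔ 1#

  opaque
    lookup-lincomb-unit-∉ : ∀ {k} (c : F.Vector Carrier k) (h : Fin k → Fin d) j → (∀ i → h i ≢ j) →
                            lookup (lincomb c (unit ∘ h)) j ≡ 0#
    lookup-lincomb-unit-∉ {zero}  c h j h≢j = lookup-replicate j 0#
    lookup-lincomb-unit-∉ {suc k} c h j h≢j = begin
      lookup (c zero • unit (h zero) +ᵛ lincomb (c ∘ suc) (unit ∘ h ∘ suc)) j
        ≡⟨ IsLinear.+-homo (lookup-isLinear j) (c zero • unit (h zero)) (lincomb (c ∘ suc) (unit ∘ h ∘ suc)) ⟩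
      lookup (c zero • unit (h zero)) j + lookup (lincomb (c ∘ suc) (unit ∘ h ∘ suc)) j
        ≡⟨ cong₂ _+_ (IsLinear.•-homo (lookup-isLinear j) (c zero) (unit (h zero)))
             (lookup-lincomb-unit-∉ (c ∘ suc) (h ∘ suc) j (h≢j ∘ suc)) ⟩
      c zero * lookup (unit (h zero)) j + 0#
        ≡⟨ cong (λ z → c zero * z + 0#) (trans (lookup∘update′ (≢-sym (h≢j zero)) 0ᵛ 1#) (lookup-replicate j 0#)) ⟩
      c zero * 0# + 0#
        ≡⟨ solve 1 (λ c → c :* :0 :+ :0 := :0) refl (c zero) ⟩
      0# ∎
      where open ≡-Reasoning

    -- An injective choice `h` of unit vectors, in place of all of them, survives the removal of the
    -- first one in the induction.
    lookup-lincomb-unit : ∀ {k} (c : F.Vector Carrier k) (h : Fin k → Fin d) →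
                          (∀ {i j} → h i ≡ h j → i ≡ j) → ∀ i → lookup (lincomb c (unit ∘ h)) (h i) ≡ c i
    lookup-lincomb-unit {suc k} c h inj i = begin
      lookup (c zero • unit (h zero) +ᵛ rest) (h i)         ≡⟨ IsLinear.+-homo (lookup-isLinear (h i)) (c zero • unit (h zero)) rest ⟩
      lookup (c zero • unit (h zero)) (h i) + lookup rest (h i)
        ≡⟨ cong (_+ lookup rest (h i)) (IsLinear.•-homo (lookup-isLinear (h i)) (c zero) (unit (h zero))) ⟩
      c zero * lookup (unit (h zero)) (h i) + lookup rest (h i) ≡⟨ at i ⟩
      c i ∎
      where
      open ≡-Reasoning
      rest : V
      rest = lincomb (c ∘ suc) (unit ∘ h ∘ suc)
      at : ∀ i → c zero * lookup (unit (h zero)) (h i) + lookup rest (h i) ≡ c i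
      at zero = trans (cong₂ (λ x y → c zero * x + y) (lookup∘update (h zero) 0ᵛ 1#)
          (lookup-lincomb-unit-∉ (c ∘ suc) (h ∘ suc) (h zero) λ i eq → Fin.0≢1+n (sym (inj eq))))
        (solve 1 (λ c → c :* :1 :+ :0 := c) refl (c zero))
      at (suc i) = trans (cong₂ (λ x y → c zero * x + y)
          (trans (lookup∘update′ (λ eq → Fin.0≢1+n (sym (inj eq))) 0ᵛ 1#) (lookup-replicate (h (suc i)) 0#))
          (lookup-lincomb-unit (c ∘ suc) (h ∘ suc) (λ eq → Fin.suc-injective (inj eq)) i))
        (solve 2 (λ c x → c :* :0 :+ x := x) refl (c zero) (c (suc i)))

    HasDim-whole : HasDim whole d
    HasDim-whole = unit
      , (λ c eq i → trans (sym (lookup-lincomb-unit c (λ j → j) (λ p → p) i))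
          (trans (cong (λ v → lookup v i) eq) (lookup-replicate i 0#)))
      , (λ {v} _ → lookup v , lookup-injective (λ i → sym (lookup-lincomb-unit (lookup v) (λ j → j) (λ p → p) i)))
      , _

-- Quadratic forms in characteristic 2 and the radical of the polar form.

module Form {q : ℕ} (F : FiniteField q)
            (1+1≡0 : Characteristic2 F) (d : ℕ)
            (f : VectorSpace.V F d → FiniteField.Carrier F)
            (isQuadratic : VectorSpace.IsQuadraticForm F d f) where
  open FiniteField F
  open Char2 F 1+1≡0 public
  open VectorSpace F d
  open Linear F 1+1≡0 d public
  open IsQuadraticForm isQuadratic using (homogeneous; polar-bilinear)
  open ≡-Reasoning

  B : V → V → Carrier
  B = polar f

  opaque
    B-linear : ∀ u → IsLinear (B u)
    B-linear u = record { +-homo = +ʳ u ; •-homo = λ c v → •ʳ c u v }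
      where open IsBilinear polar-bilinear

    B-sym : ∀ u v → B u v ≡ B v u
    B-sym u v = trans
      (solve 3 (λ a b c → a :- b :- c := a :- c :- b) refl (f (u +ᵛ v)) (f u) (f v))
      (cong (λ w → f w - f v - f u) (+ᵛ-comm u v))

    f-+ : ∀ u v → f (u +ᵛ v) ≡ f u + f v + B u v
    f-+ u v = solve 3 (λ a b c → a := b :+ c :+ (a :- b :- c)) refl (f (u +ᵛ v)) (f u) (f v)

  opaque
    B-+ˡ : ∀ u v w → B (u +ᵛ v) w ≡ B u w + B v w
    B-+ˡ = IsBilinear.+ˡ polar-bilinear

    B-•ˡ : ∀ c u v → B (c • u) v ≡ c * B u v
    B-•ˡ = IsBilinear.•ˡ polar-bilinear

    B-+ʳ : ∀ u v w → B u (v +ᵛ w) ≡ B u v + B u w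
    B-+ʳ = IsBilinear.+ʳ polar-bilinear

    B-•ʳ : ∀ c u v → B u (c • v) ≡ c * B u v
    B-•ʳ = IsBilinear.•ʳ polar-bilinear

    B-+•ʳ : ∀ u v c w → B u (v +ᵛ c • w) ≡ B u v + c * B u w
    B-+•ʳ u v c w = trans (B-+ʳ u v (c • w)) (cong (B u v +_) (B-•ʳ c u w))

    f-• : ∀ c v → f (c • v) ≡ c * c * f v
    f-• = homogeneous

    f-+• : ∀ u c v → f (u +ᵛ c • v) ≡ f u + c * c * f v + c * B u v
    f-+• u c v = trans (f-+ u (c • v)) (cong₂ (λ x y → f u + x + y) (f-• c v) (B-•ʳ c u v))

    f-0 : f 0ᵛ ≡ 0#
    f-0 = trans (cong f (sym (0•v≡0 0ᵛ))) (trans (f-• 0# 0ᵛ)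
      (solve 1 (λ x → :0 :* :0 :* x := :0) refl (f 0ᵛ)))

    B-alternating : ∀ u → B u u ≡ 0#
    B-alternating u = begin
      B u u                  ≡⟨ solve 2 (λ a b → b := a :+ a :+ b) refl (f u) (B u u) ⟩
      f u + f u + B u u      ≡⟨ f-+ u u ⟨
      f (u +ᵛ u)             ≡⟨ cong f (v+v≡0 u) ⟩
      f 0ᵛ                   ≡⟨ f-0 ⟩
      0#                     ∎

  opaque
    f-+•≡0 : ∀ {u v} → f u ≡ 0# → f v ≡ 0# → B u v ≡ 0# → ∀ c → f (u +ᵛ c • v) ≡ 0#
    f-+•≡0 {u} {v} fu fv Buv c = trans (f-+• u c v)
      (trans (cong₂ _+_ (cong₂ (λ x y → x + c * c * y) fu fv) (cong (c *_) Buv))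
        (solve 1 (λ c → :0 :+ c :* c :* :0 :+ c :* :0 := :0) refl c))

    f-•≡0 : ∀ {v} → f v ≡ 0# → ∀ c → f (c • v) ≡ 0#
    f-•≡0 fv c = trans (f-• c _) (trans (cong (c * c *_) fv) (zeroʳ _))

    B-sym-≡ : ∀ {u v c} → B u v ≡ c → B v u ≡ c
    B-sym-≡ eq = trans (B-sym _ _) eq

    -- `f (h +ᵛ t • p)` equals `f h + t`, so taking `f h` for `t` gives the second singular point of
    -- the hyperbolic line through `p` and `h`.
    hyperbolic : ∀ {p h} → f p ≡ 0# → B p h ≡ 1# → f (h +ᵛ f h • p) ≡ 0#
    hyperbolic {p} {h} fp Bph = trans (f-+• h (f h) p)
      (trans (cong₂ (λ x y → f h + f h * f h * x + f h * y) fp (B-sym-≡ Bph))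
        (solve 1 (λ a → a :+ a :* a :* :0 :+ a :* :1 := :0) refl (f h)))

  opaque
    TotallySingular⇒⊥ : ∀ {T} → TotallySingular f T → ∀ {u v} → u ∈ ∣ T ∣ → v ∈ ∣ T ∣ → B u v ≡ 0#
    TotallySingular⇒⊥ {T} ts {u} {v} u∈T v∈T = begin
      B u v                ≡⟨ solve 1 (λ b → b := :0 :+ :0 :+ b) refl (B u v) ⟩
      0# + 0# + B u v      ≡⟨ cong₂ (λ x y → x + y + B u v) (ts u u∈T) (ts v v∈T) ⟨
      f u + f v + B u v    ≡⟨ f-+ u v ⟨
      f (u +ᵛ v)           ≡⟨ ts (u +ᵛ v) (+-closed T u∈T v∈T) ⟩
      0#                   ∎

  infixl 6 _∩⊥_
  _∩⊥_ : Subspace → V → Subspace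
  W ∩⊥ v = kernel W (B-linear v)

  opaque
    TotallySingular-adjoin : ∀ {T} → TotallySingular f T → ∀ {x} → f x ≡ 0# →
                             (∀ {t} → t ∈ ∣ T ∣ → B x t ≡ 0#) → TotallySingular f (adjoin x T)
    TotallySingular-adjoin {T} ts {x} fx x⊥T u (c , p) = begin
      f u                        ≡⟨ cong f (u+v+v≡u u (c • x)) ⟨
      f (u +ᵛ c • x +ᵛ c • x)    ≡⟨ f-+•≡0 (ts _ p) fx (B-sym-≡ (x⊥T p)) c ⟩
      0#                         ∎

    TotallySingular-zero : TotallySingular f zeroSubspace
    TotallySingular-zero u (_ , u≡0) = trans (cong f u≡0) f-0

  opaque
    kernel-+•⁻¹ : ∀ {g} → IsLinear g → ∀ {u v c} → g (u +ᵛ c • v) ≡ 0# → g v ≡ 0# → g u ≡ 0#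
    kernel-+•⁻¹ {g} lin {u} {v} {c} eq gv≡0 =
      trans (cong g (sym (u+v+v≡u u (c • v)))) (+•-kernel lin eq gv≡0 c)

  opaque
    -- Since `B v w` is nonzero, `W` is the orthogonal sum of `⟨v, w⟩` and `W ∩⊥ v ∩⊥ w`.
    vanishes-on-split : ∀ W {v w} → v ∈ ∣ W ∣ → w ∈ ∣ W ∣ → B v w ≢ 0# →
                        ∀ {g} → IsLinear g → g v ≡ 0# → g w ≡ 0# →
                        (∀ {u} → u ∈ ∣ W ∩⊥ v ∩⊥ w ∣ → g u ≡ 0#) → ∀ {u} → u ∈ ∣ W ∣ → g u ≡ 0#
    vanishes-on-split W {v} {w} v∈W w∈W Bvw≢0 lin gv gw gU {u} u∈W
      -- A multiple of `w` makes `u` orthogonal to `v`; a multiple of `v` then makes it orthogonal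
      -- to `w` and, `B` being alternating, preserves the former.
      with c , eq ← kernel-projection (B-linear v) Bvw≢0 u
      with e , eq′ ← kernel-projection (B-linear w) (Bvw≢0 ∘ B-sym-≡) (u +ᵛ c • w)
      = kernel-+•⁻¹ lin (kernel-+•⁻¹ lin (gU
          ((+-closed W (+-closed W u∈W (•-closed W c w∈W)) (•-closed W e v∈W)
          , +•-kernel (B-linear v) eq (B-alternating v) e) , eq′)) gv) gw

  opaque
    -- An alternating form has even rank: pairs with `B v w` nonzero are split off, two dimensions
    -- at a time, until a radical vector appears.
    odd-radical : ∀ k W → HasDim W (suc (k ℕ.* 2)) →
                  ∃ λ r → r ∈ ∣ W ∣ × r ≢ 0ᵛ × (∀ {w} → w ∈ ∣ W ∣ → B r w ≡ 0#)
    odd-radical zero W dimW = by dimW (HasDim-nonzero {W} dimW)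
      where
      by : HasDim W 1 → (∃ λ v → v ∈ ∣ W ∣ × v ≢ 0ᵛ) →
           ∃ λ r → r ∈ ∣ W ∣ × r ≢ 0ᵛ × (∀ {w} → w ∈ ∣ W ∣ → B r w ≡ 0#)
      by W-dim (v , v∈W , v≢0) = v , v∈W , v≢0 , Bv
        where
        Bv : ∀ {w} → w ∈ ∣ W ∣ → B v w ≡ 0#
        Bv {w} w∈W with vanishes? {W} (B-linear v) W-dim
        ... | inj₂ Bv≡0 = Bv≡0 w∈W
        -- Otherwise the kernel of `B v` on `W` would have dimension 0, although it contains `v`.
        ... | inj₁ (u , u∈W , Bvu≢0)
          with _ , _ , ⊆0 , _ ← HasDim-kernel {W} (B-linear v) W-dim u∈W Bvu≢0
          = contradiction (proj₂ (⊆0 {v} (v∈W , B-alternating v))) v≢0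
    odd-radical (suc k) W W-dim
      with v , v∈W , v≢0 ← HasDim-nonzero {W} W-dim
      with vanishes? {W} (B-linear v) W-dim
    ... | inj₂ Bv≡0 = v , v∈W , v≢0 , Bv≡0
    ... | inj₁ (w , w∈W , Bvw≢0)
      with r , ((r∈W , Bvr) , Bwr) , r≢0 , Br ← odd-radical k (W ∩⊥ v ∩⊥ w)
             (HasDim-kernel {W ∩⊥ v} (B-linear w) (HasDim-kernel {W} (B-linear v) W-dim w∈W Bvw≢0)
               (v∈W , B-alternating v) (Bvw≢0 ∘ B-sym-≡))
      = r , r∈W , r≢0
      , vanishes-on-split W v∈W w∈W Bvw≢0 (B-linear r) (B-sym-≡ Bvr) (B-sym-≡ Bwr) Br

  opaque
    f-scale-to-1 : ∀ {v} → f v ≢ 0# → ∃ λ c → f (c • v) ≡ 1#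
    f-scale-to-1 {v} fv≢0 with b , fv*b≡1 ← inverse (f v) fv≢0 with c , c²≡b ← sqrt b =
      c , trans (f-• c v) (trans (cong (_* f v) c²≡b) (trans (*-comm b (f v)) fv*b≡1))

  -- In even dimension the radical of the polar form cannot be a line: a complementary hyperplane
  -- would have a radical vector too, and a quadratic form that is additive on a plane over a perfect
  -- field has a nonzero zero there.
  opaque
    even-radical : ∀ k {W} → HasDim W (suc (suc (k ℕ.* 2))) → NonDegenerateOn f W →
                   ∀ {r} → r ∈ ∣ W ∣ → (∀ {w} → w ∈ ∣ W ∣ → B r w ≡ 0#) → r ≡ 0ᵛ
    even-radical k {W} W-dim nondeg {r} r∈W Br = decidable-stable (r ≟ᵛ 0ᵛ) λ r≢0 →
      absurd r≢0 (nonzero-coordinate r≢0)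
      where
      absurd : r ≢ 0ᵛ → ¬ (∃ λ i → lookup r i ≢ 0#)
      absurd r≢0 (i , rᵢ≢0)
        with s , (s∈W , sᵢ≡0) , s≢0 , Bs ← odd-radical k (kernel W (lookup-isLinear i))
               (HasDim-kernel {W} (lookup-isLinear i) W-dim r∈W rᵢ≢0)
        with c , fcr≡1 ← f-scale-to-1 {r} (λ fr → r≢0 (nondeg r r∈W fr λ w w∈W → Br w∈W))
        with t , t²≡fs ← sqrt (f s)
        = s≢0 s≡0
        where
        Bs′ : ∀ {w} → w ∈ ∣ W ∣ → B s w ≡ 0#
        Bs′ {w} w∈W with a , eq ← kernel-projection (lookup-isLinear i) rᵢ≢0 w =
          kernel-+•⁻¹ (B-linear s) (Bs (+-closed W w∈W (•-closed W a r∈W) , eq)) (B-sym-≡ (Br s∈W))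
        -- As `f (c • r)` is 1 and `t * t` is `f s`, the two contributions to `f z` cancel.
        z : V
        z = s +ᵛ t • c • r
        z≡0 : z ≡ 0ᵛ
        z≡0 = nondeg z (+-closed W s∈W (•-closed W t (•-closed W c r∈W)))
          (begin
            f z                                      ≡⟨ f-+• s t (c • r) ⟩
            f s + t * t * f (c • r) + t * B s (c • r) ≡⟨ cong₂ (λ x y → f s + x * f (c • r) + t * y) t²≡fs
                                                          (Bs′ (•-closed W c r∈W)) ⟩
            f s + f s * f (c • r) + t * 0#           ≡⟨ cong (λ x → f s + f s * x + t * 0#) fcr≡1 ⟩
            f s + f s * 1# + t * 0#                  ≡⟨ solve 2 (λ a t → a :+ a :* :1 :+ t :* :0 := :0) refl (f s) t ⟩
            0#                                       ∎)
          λ w w∈W → B-sym-≡ (trans (B-+ʳ w s _) (trans (cong₂ _+_ (B-sym-≡ (Bs′ w∈W))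
            (trans (B-•ʳ t w _) (cong (t *_) (trans (B-•ʳ c w r) (cong (c *_) (B-sym-≡ (Br w∈W)))))))
            (solve 2 (λ t c → :0 :+ t :* (c :* :0) := :0) refl t c)))
        -- Coordinate `i` vanishes on `s` but not on `r`, so `z ≡ 0ᵛ` forces the coefficient of `r`,
        -- and then `s`, to vanish.
        tc≡0 : t * c ≡ 0#
        tc≡0 = +•-kernel-coefficient (lookup-isLinear i) {s} {r} sᵢ≡0 rᵢ≢0 (begin
          lookup (s +ᵛ (t * c) • r) i  ≡⟨ cong (λ x → lookup x i) (coordinatewise (𝟎 ⊕ (t * c) ⊙ 𝟏)
                                           (𝟎 ⊕ t ⊙ c ⊙ 𝟏) (λ { (x ∷ y ∷ []) → cong (x +_) (*-assoc t c y) }) (s ∷ r ∷ [])) ⟩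
          lookup z i                   ≡⟨ cong (λ x → lookup x i) z≡0 ⟩
          lookup 0ᵛ i                  ≡⟨ IsLinear.0-homo (lookup-isLinear i) ⟩
          0#                           ∎)
        s≡0 : s ≡ 0ᵛ
        s≡0 = begin
          s                    ≡⟨ u+0•v≡u s r ⟨
          s +ᵛ 0# • r          ≡⟨ cong (λ a → s +ᵛ a • r) tc≡0 ⟨
          s +ᵛ (t * c) • r     ≡⟨ coordinatewise (𝟎 ⊕ (t * c) ⊙ 𝟏) (𝟎 ⊕ t ⊙ c ⊙ 𝟏)
                                   (λ { (x ∷ y ∷ []) → cong (x +_) (*-assoc t c y) }) (s ∷ r ∷ []) ⟩
          z                    ≡⟨ z≡0 ⟩
          0ᵛ                   ∎

  opaque
    partner : ∀ {W k p} → HasDim W k → (∀ {r} → r ∈ ∣ W ∣ → (∀ {w} → w ∈ ∣ W ∣ → B r w ≡ 0#) → r ≡ 0ᵛ) →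
              p ∈ ∣ W ∣ → p ≢ 0ᵛ → ∃ λ h → h ∈ ∣ W ∣ × B p h ≡ 1#
    partner {W} {k} {p} W-dim rad≡0 p∈W p≢0 with vanishes? {W} (B-linear p) W-dim
    ... | inj₂ Bp≡0 = contradiction (rad≡0 p∈W Bp≡0) p≢0
    ... | inj₁ (w , w∈W , Bpw≢0) with c , eq ← inverse (B p w) Bpw≢0 =
      c • w , •-closed W c w∈W , trans (B-•ʳ c p w) (trans (*-comm c _) eq)

    -- Gram-Schmidt against a symplectic pair; the coefficients appear crosswise because `p` and `h`
    -- are each orthogonal to themselves and have product 1.
    orthogonalise : ∀ {p h} → B p h ≡ 1# → ∀ a →
                    let a′ = a +ᵛ B h a • p +ᵛ B p a • h in B p a′ ≡ 0# × B h a′ ≡ 0#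
    orthogonalise {p} {h} Bph a =
        trans (B-+•ʳ p _ _ h) (trans (cong₂ (λ x y → x + B p a * y)
          (trans (B-+•ʳ p a _ p) (cong (λ x → B p a + B h a * x) (B-alternating p))) Bph)
          (solve 2 (λ x y → x :+ y :* :0 :+ x :* :1 := :0) refl (B p a) (B h a)))
      , trans (B-+•ʳ h _ _ h) (trans (cong₂ (λ x y → x + B p a * y)
          (trans (B-+•ʳ h a _ p) (cong (λ x → B h a + B h a * x) (B-sym-≡ Bph))) (B-alternating h))
          (solve 2 (λ x y → y :+ y :* :1 :+ x :* :0 := :0) refl (B p a) (B h a)))

-- The nucleus, normalised affine points and their elliptic solids.

module Configuration
  {q : ℕ} (F : FiniteField q) (1+1≡0 : Characteristic2 F)
  (f : VectorSpace.V F 6 → FiniteField.Carrier F)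
  (isQuadratic : VectorSpace.IsQuadraticForm F 6 f)
  (f-nondeg : VectorSpace.NonDegenerateOn F 6 f (VectorSpace.whole F 6))
  (f-witt : VectorSpace.HasWittIndexOn F 6 f (VectorSpace.whole F 6) 2)
  (H₀ : VectorSpace.Subspace F 6)
  (H₀-dim : VectorSpace.HasDim F 6 H₀ 5)
  (H₀-nondeg : VectorSpace.NonDegenerateOn F 6 f H₀) where
  open FiniteField F
  open VectorSpace F 6
  open Form F 1+1≡0 6 f isQuadratic public
  open Quadric F f H₀ public
  open ≡-Reasoning

  opaque
    radical≡0 : ∀ {r} → (∀ w → B r w ≡ 0#) → r ≡ 0ᵛ
    radical≡0 Br = even-radical 2 {whole} HasDim-whole f-nondeg _ (λ {w} _ → Br w)

    -- Adjoining a `z` outside `T` would give a totally singular subspace of dimension 3, against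
    -- Witt index 2.
    maximal-TotallySingular : ∀ {T} → HasDim T 2 → TotallySingular f T →
                              ∀ {z} → f z ≡ 0# → (∀ {t} → t ∈ ∣ T ∣ → B z t ≡ 0#) → z ∈ ∣ T ∣
    maximal-TotallySingular {T} T-dim ts {z} fz z⊥T = decidable-stable (∈? {T} T-dim z) λ z∉T →
      ℕ.<-irrefl refl (HasWittIndexOn.maximal f-witt (adjoin z T) 3 _
        (TotallySingular-adjoin {T} ts fz z⊥T) (HasDim-adjoin {z} {T} z∉T T-dim))

    -- On `H₀`, of odd dimension 5, the polar form has a radical vector; it is nonsingular because
    -- `f` is non-degenerate there, so it can be scaled to value 1.
    nucleus : ∃ λ ν → ν ∈ ∣ H₀ ∣ × f ν ≡ 1# × (∀ {w} → w ∈ ∣ H₀ ∣ → B ν w ≡ 0#)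
    nucleus with r , r∈H₀ , r≢0 , Br ← odd-radical 2 H₀ H₀-dim
      with c , eq ← f-scale-to-1 {r} (λ fr → r≢0 (H₀-nondeg r r∈H₀ fr λ w w∈H₀ → Br w∈H₀))
      = c • r , •-closed H₀ c r∈H₀ , eq , λ {w} w∈H₀ →
          trans (B-•ˡ c r w) (trans (cong (c *_) (Br w∈H₀)) (zeroʳ c))

  ν : V
  ν = proj₁ nucleus

  ν∈H₀ : ν ∈ ∣ H₀ ∣
  ν∈H₀ = proj₁ (proj₂ nucleus)

  fν≡1 : f ν ≡ 1#
  fν≡1 = proj₁ (proj₂ (proj₂ nucleus))

  ν⊥H₀ : ∀ {w} → w ∈ ∣ H₀ ∣ → B ν w ≡ 0#
  ν⊥H₀ = proj₂ (proj₂ (proj₂ nucleus))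

  opaque
    ν-partner : ∃ λ a → B ν a ≡ 1#
    ν-partner with a , _ , eq ← partner {whole} {p = ν} HasDim-whole (λ _ Br → radical≡0 (λ w → Br _)) _
        (λ ν≡0 → 0≢1 (trans (sym f-0) (trans (cong f (sym ν≡0)) fν≡1)))
      = a , eq

    -- `H₀` lies in the perp of `ν`, and both have dimension 5.
    ⊥ν⇒∈H₀ : ∀ {w} → B ν w ≡ 0# → w ∈ ∣ H₀ ∣
    ⊥ν⇒∈H₀ {w} eq with a , νa≡1 ← ν-partner =
      ⊆∧dim⇒⊇ {H₀} {whole ∩⊥ ν} H₀-dim
        (HasDim-kernel {whole} (B-linear ν) HasDim-whole {a} _ (λ νa≡0 → 0≢1 (trans (sym νa≡0) νa≡1)))
        (λ w∈H₀ → _ , ν⊥H₀ w∈H₀) (_ , eq)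

  record Affine (x : V) : Set where
    constructor affine
    field
      singular : f x ≡ 0#
      ν-value  : B ν x ≡ 1#

    ν-valueʳ : B x ν ≡ 1#
    ν-valueʳ = B-sym-≡ ν-value

    ∉H₀ : x ∉ ∣ H₀ ∣
    ∉H₀ x∈H₀ = 0≢1 (trans (sym (ν⊥H₀ x∈H₀)) ν-value)

  open Affine

  -- `f (x +ᵛ t • ν)` equals `℘ t`, so the line through `x` and the nucleus has just two singular
  -- points, `x` and this twin.
  twin-affine : ∀ {x} → Affine x → Affine (x +ᵛ ν)
  twin-affine {x} (affine fx νx) = affine
    (trans (f-+ x ν) (trans (cong₂ _+_ (cong₂ _+_ fx fν≡1) (B-sym-≡ νx))
      (solve 0 (:0 :+ :1 :+ :1 := :0) refl)))
    (trans (B-+ʳ ν x ν) (trans (cong₂ _+_ νx (B-alternating ν)) (+-identityʳ 1#)))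

  opaque
    twin-not-⊥ : ∀ {x} → Affine x → B x (x +ᵛ ν) ≡ 1#
    twin-not-⊥ {x} ax = trans (B-+ʳ x x ν) (trans (cong₂ _+_ (B-alternating x) (ν-valueʳ ax)) (+-identityˡ 1#))

  solid : V → Subspace
  solid x = H₀ ∩⊥ x

  module _ {x : V} (ax : Affine x) where
    opaque
      solid-dim : HasDim (solid x) 4
      solid-dim = HasDim-kernel {H₀} (B-linear x) H₀-dim ν∈H₀
        (λ eq → 0≢1 (trans (sym eq) (ν-valueʳ ax)))

      -- `V` is the orthogonal sum of `⟨x, ν⟩` and the solid.
      vanishes-on-solid+ : ∀ {g} → IsLinear g → g x ≡ 0# → g ν ≡ 0# →
                           (∀ {u} → u ∈ ∣ solid x ∣ → g u ≡ 0#) → ∀ u → g u ≡ 0#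
      vanishes-on-solid+ {g} lin gx gν gS u = vanishes-on-split whole {x} {ν} _ _
        (λ eq → 0≢1 (trans (sym eq) (ν-valueʳ ax))) lin gx gν
        (λ ((_ , Bxu) , Bνu) → gS (⊥ν⇒∈H₀ Bνu , Bxu)) {u} _

      solid-radical : ∀ {r} → r ∈ ∣ solid x ∣ → (∀ {w} → w ∈ ∣ solid x ∣ → B r w ≡ 0#) → r ≡ 0ᵛ
      solid-radical {r} (r∈H₀ , Bxr) Br = radical≡0
        (vanishes-on-solid+ (B-linear r) (B-sym-≡ Bxr) (B-sym-≡ (ν⊥H₀ r∈H₀)) Br)

      solid-nondeg : NonDegenerateOn f (solid x)
      solid-nondeg v v∈S _ Bv = solid-radical v∈S (λ {w} → Bv w)

    opaque
      -- A totally singular line `T` meets the perps of `ν` and of `x`. If neither point found lies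
      -- in both perps, the line joining `x` to the point `u` of `T` orthogonal to it is totally
      -- singular and meets `H₀` in a point of the solid.
      solid-singular : ∃ λ p → p ∈ ∣ solid x ∣ × p ≢ 0ᵛ × f p ≡ 0#
      solid-singular
        with T , _ , ts , T-dim ← HasWittIndexOn.attained f-witt
        with p , (p∈T , νp) , p≢0 ← nonzero-in-kernel {T} (B-linear ν) T-dim
        with u , (u∈T , Bxu) , u≢0 ← nonzero-in-kernel {T} (B-linear x) T-dim
        with B x p ≟ 0# | B ν u ≟ 0#
      ... | yes Bxp | _       = p , (⊥ν⇒∈H₀ νp , Bxp) , p≢0 , ts p p∈T
      ... | no _    | yes νu  = u , (⊥ν⇒∈H₀ νu , Bxu) , u≢0 , ts u u∈T
      ... | no Bxp≢0 | no νu≢0 with c , eq ← inverse (B ν u) νu≢0 =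
        x +ᵛ c • u
        , ( ⊥ν⇒∈H₀ (trans (B-+•ʳ ν x c u) (trans (cong₂ _+_ (ν-value ax) (trans (*-comm c _) eq)) (x+x≡0 1#)))
          , trans (B-+•ʳ x x c u) (trans (cong₂ (λ a b → a + c * b) (B-alternating x) Bxu)
              (solve 1 (λ c → :0 :+ c :* :0 := :0) refl c)))
        -- If the vector were zero, `x` would be in `T`, hence orthogonal to `p`.
        , (λ eq′ → Bxp≢0 (trans (cong (λ z → B z p) (u+v≡0⇒u≡v eq′))
              (TotallySingular⇒⊥ {T} ts (•-closed T c u∈T) p∈T)))
        , f-+•≡0 (singular ax) (ts u u∈T) Bxu c

    opaque
      solid-wittIndex : HasWittIndexOn f (solid x) 1
      solid-wittIndex = record
        { attained = attained′ solid-singular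
        -- `x` is singular, orthogonal to the solid and outside `H₀`, so adjoining it raises the
        -- dimension by one; the bound 2 on `V` becomes the bound 1 here.
        ; maximal  = λ T k T⊆S ts T-dim → ℕ.s≤s⁻¹ (HasWittIndexOn.maximal f-witt (adjoin x T) (suc k) _
            (TotallySingular-adjoin {T} ts (singular ax) (λ t∈T → proj₂ (T⊆S t∈T)))
            (HasDim-adjoin {x} {T} (λ x∈T → ∉H₀ ax (proj₁ (T⊆S x∈T))) T-dim))
        }
        where
        attained′ : (∃ λ p → p ∈ ∣ solid x ∣ × p ≢ 0ᵛ × f p ≡ 0#) →
                    Σ Subspace λ T → ∣ T ∣ ⊆ ∣ solid x ∣ × TotallySingular f T × HasDim T 1
        attained′ (p , p∈S , p≢0 , fp) = adjoin p zeroSubspace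
          , adjoin-⊆ p zeroSubspace (solid x) p∈S
              (λ (_ , u≡0) → subst (_∈ ∣ solid x ∣) (sym u≡0) (0-closed (solid x)))
          , TotallySingular-adjoin {zeroSubspace} TotallySingular-zero fp
              (λ (_ , t≡0) → trans (cong (B p) t≡0) (IsLinear.0-homo (B-linear p)))
          , HasDim-adjoin {p} {zeroSubspace} (v∉0 p≢0) HasDim-zero

    solid-elliptic : IsEllipticSolid (solid x)
    solid-elliptic = record
      { inside        = proj₁
      ; dimension     = solid-dim
      ; nonDegenerate = solid-nondeg
      ; wittIndex     = solid-wittIndex
      }

    opaque
      -- The `x` component of `w` is 1, as both vectors have the same product with `ν`, and the `ν`
      -- component is `B x w`.
      affine-coordinates : ∀ {w} → Affine w → ∃ λ a → w +ᵛ x +ᵛ a • ν ∈ ∣ solid x ∣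
      affine-coordinates {w} aw = B x w
        , ⊥ν⇒∈H₀ (trans (B-+•ʳ ν _ _ ν) (trans (cong₂ (λ y z → y + B x w * z)
            (trans (B-+ʳ ν w x) (cong₂ _+_ (ν-value aw) (ν-value ax))) (B-alternating ν))
            (solve 1 (λ a → :1 :+ :1 :+ a :* :0 := :0) refl (B x w))))
        , trans (B-+•ʳ x _ _ ν) (trans (cong₂ (λ y z → y + B x w * z)
            (trans (B-+ʳ x w x) (cong (B x w +_) (B-alternating x))) (ν-valueʳ ax))
            (solve 1 (λ a → a :+ :0 :+ a :* :1 := :0) refl (B x w)))

    opaque
      B-on-solid : ∀ w a {z} → z ∈ ∣ solid x ∣ → B (w +ᵛ x +ᵛ a • ν) z ≡ B w z
      B-on-solid w a {z} (z∈H₀ , Bxz) = B-sym-≡ (begin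
        B z (w +ᵛ x +ᵛ a • ν)       ≡⟨ B-+•ʳ z _ a ν ⟩
        B z (w +ᵛ x) + a * B z ν    ≡⟨ cong₂ (λ y b → y + a * b) (B-+ʳ z w x) (B-sym-≡ (ν⊥H₀ z∈H₀)) ⟩
        B z w + B z x + a * 0#      ≡⟨ cong₂ (λ y b → y + b + a * 0#) (B-sym z w) (B-sym-≡ Bxz) ⟩
        B w z + 0# + a * 0#         ≡⟨ solve 2 (λ b a → b :+ :0 :+ a :* :0 := b) refl (B w z) a ⟩
        B w z                       ∎)

    opaque
      -- Expanding `f (x +ᵛ u +ᵛ a • ν)` leaves `℘ a`, so `a` is 0 or 1.
      affine-singular-difference : ∀ {w} → Affine w → ∀ {u} → u ∈ ∣ solid x ∣ → f u ≡ 0# →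
                                   ∀ a → w +ᵛ x +ᵛ a • ν ≡ u → w ≡ x +ᵛ u ⊎ w ≡ x +ᵛ u +ᵛ ν
      affine-singular-difference {w} aw {u} (u∈H₀ , Bxu) fu a eq = by (℘x≡0⇒x≡0∨x≡1 (begin
        a * a + a
          ≡⟨ solve 1 (λ a → a :* a :+ a := :0 :+ :0 :+ :0 :+ a :* a :* :1 :+ a :* (:1 :+ :0)) refl a ⟩
        0# + 0# + 0# + a * a * 1# + a * (1# + 0#)
          ≡⟨ cong₂ (λ y z → y + a * a * z + a * (1# + 0#)) (cong₂ _+_ (cong₂ _+_ (singular ax) fu) Bxu) fν≡1 ⟨
        f x + f u + B x u + a * a * f ν + a * (1# + 0#)
          ≡⟨ cong₂ (λ y z → f x + f u + B x u + a * a * f ν + a * (y + z)) (ν-value ax) (ν⊥H₀ u∈H₀) ⟨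
        f x + f u + B x u + a * a * f ν + a * (B ν x + B ν u)
          ≡⟨ cong₂ (λ y z → y + a * a * f ν + a * z) (f-+ x u) (trans (B-sym _ ν) (B-+ʳ ν x u)) ⟨
        f (x +ᵛ u) + a * a * f ν + a * B (x +ᵛ u) ν
          ≡⟨ f-+• (x +ᵛ u) a ν ⟨
        f (x +ᵛ u +ᵛ a • ν)
          ≡⟨ cong f w≡ ⟨
        f w
          ≡⟨ singular aw ⟩
        0# ∎))
        where
        w≡ : w ≡ x +ᵛ u +ᵛ a • ν
        w≡ = trans (coordinatewise 𝟎 (𝟏 ⊕ (𝟎 ⊕ 𝟏 ⊕ a ⊙ 𝟐) ⊕ a ⊙ 𝟐)
          (λ { (w ∷ x ∷ v ∷ []) → solve 4 (λ a w x v → w := x :+ (w :+ x :+ a :* v) :+ a :* v) refl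
             a w x v }) (w ∷ x ∷ ν ∷ [])) (cong (λ y → x +ᵛ y +ᵛ a • ν) eq)
        by : a ≡ 0# ⊎ a ≡ 1# → w ≡ x +ᵛ u ⊎ w ≡ x +ᵛ u +ᵛ ν
        by (inj₁ a≡0) = inj₁ (trans w≡ (trans (cong (λ a → x +ᵛ u +ᵛ a • ν) a≡0) (u+0•v≡u _ ν)))
        by (inj₂ a≡1) = inj₂ (trans w≡ (trans (cong (λ a → x +ᵛ u +ᵛ a • ν) a≡1)
          (cong (x +ᵛ u +ᵛ_) (•-identityˡ ν))))

    solid-partner : ∀ {p} → p ∈ ∣ solid x ∣ → p ≢ 0ᵛ → ∃ λ h → h ∈ ∣ solid x ∣ × B p h ≡ 1#
    solid-partner = partner {solid x} solid-dim solid-radical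

    -- Modulo a singular p, every vector not orthogonal to p is a multiple of a singular one.
    opaque
      singular-span : ∀ {g} → IsLinear g → (∀ {z} → z ∈ ∣ solid x ∣ → f z ≡ 0# → g z ≡ 0#) →
                      ∀ {z} → z ∈ ∣ solid x ∣ → g z ≡ 0#
      singular-span {g} lin g0 {z} z∈S
        with p , p∈S , p≢0 , fp ← solid-singular
        with h , h∈S , Bph ← solid-partner p∈S p≢0
        = by (B p z ≟ 0#)
        where
        unit-case : ∀ {w} → w ∈ ∣ solid x ∣ → B p w ≡ 1# → g w ≡ 0#
        unit-case {w} w∈S Bpw = kernel-+•⁻¹ lin
          (g0 (+-closed (solid x) w∈S (•-closed (solid x) (f w) p∈S)) (hyperbolic fp Bpw)) (g0 p∈S fp)
        nonzero-case : ∀ {w} → w ∈ ∣ solid x ∣ → B p w ≢ 0# → g w ≡ 0#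
        nonzero-case {w} w∈S Bpw≢0 with c , eq ← inverse (B p w) Bpw≢0
          with x*y≡0⇒x≡0∨y≡0 (trans (sym (IsLinear.•-homo lin c w)) (unit-case (•-closed (solid x) c w∈S)
                 (trans (B-•ʳ c p w) (trans (*-comm c _) eq))))
        ... | inj₁ c≡0 = contradiction (trans (sym (zeroʳ (B p w))) (trans (cong (B p w *_) (sym c≡0)) eq)) 0≢1
        ... | inj₂ gw≡0 = gw≡0
        by : Dec (B p z ≡ 0#) → g z ≡ 0#
        by (no Bpz≢0) = nonzero-case z∈S Bpz≢0
        -- If `z` is orthogonal to `p`, then `z +ᵛ 1# • h` and `h` both have product 1 with `p`.
        by (yes Bpz≡0) = kernel-+•⁻¹ lin {c = 1#} (unit-case
          (+-closed (solid x) z∈S (•-closed (solid x) 1# h∈S))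
          (trans (B-+•ʳ p z 1# h) (trans (cong₂ (λ a b → a + 1# * b) Bpz≡0 Bph)
            (solve 0 (:0 :+ :1 :* :1 := :1) refl)))) (unit-case h∈S Bph)

    opaque
      same-ovoid : ∀ {w} → Affine w → (∀ {z} → z ∈ ∣ solid x ∣ → f z ≡ 0# → B w z ≡ 0#) →
                   w ≡ x ⊎ w ≡ x +ᵛ ν
      same-ovoid {w} aw w⊥ with a , u∈S ← affine-coordinates aw =
        [ (λ eq → inj₁ (trans eq (+ᵛ-identityʳ x)))
        , (λ eq → inj₂ (trans eq (cong (_+ᵛ ν) (+ᵛ-identityʳ x)))) ]′
        (affine-singular-difference aw (0-closed (solid x)) f-0 a (solid-radical u∈S (λ z∈S →
          trans (B-on-solid w a z∈S) (singular-span (B-linear w) w⊥ z∈S))))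

    opaque
      -- With `u` the component of `w` in the solid, the last hypothesis forces `B p` to vanish
      -- wherever `B u` does, so the two functionals are proportional; comparing them at a partner
      -- `h` of `p` gives `u ≡ B u h • p`.
      tangent : ∀ {w} → Affine w → ∀ {p} → p ≢ 0ᵛ → p ∈ ∣ solid x ∣ → f p ≡ 0# → B w p ≡ 0# →
                (∀ {z} → z ∈ ∣ solid x ∣ → f z ≡ 0# → B w z ≡ 0# → B p z ≡ 0#) →
                ∃ λ c → w ≡ x +ᵛ c • p ⊎ w ≡ x +ᵛ c • p +ᵛ ν
      tangent {w} aw {p} p≢0 p∈S fp Bwp only-p
        with a , u∈S ← affine-coordinates aw
        with h , h∈S , Bph ← solid-partner p∈S p≢0
        = B u h , affine-singular-difference aw (•-closed (solid x) (B u h) p∈S) (f-•≡0 fp (B u h)) a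
            (u+v≡0⇒u≡v (solid-radical (+-closed (solid x) u∈S (•-closed (solid x) (B u h) p∈S)) ⊥S))
        where
        u : V
        u = w +ᵛ x +ᵛ a • ν
        Bup : B u p ≡ 0#
        Bup = trans (B-on-solid w a p∈S) Bwp
        -- Where B u vanishes on the solid so does B p, since z + f z • p is singular if B p z = 1.
        ⊥u⇒⊥p : ∀ {z} → z ∈ ∣ solid x ∣ → B u z ≡ 0# → B p z ≡ 0#
        ⊥u⇒⊥p {z} z∈S Buz = decidable-stable (B p z ≟ 0#) λ Bpz≢0 → absurd (inverse (B p z) Bpz≢0)
          where
          absurd : ¬ (∃ λ c → B p z * c ≡ 1#)
          absurd (c , eq) = 0≢1 (trans (sym (only-p s∈S (hyperbolic fp Bpy)
              (trans (sym (B-on-solid w a s∈S)) (+•-kernel (B-linear u)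
                (trans (B-•ʳ c u z) (trans (cong (c *_) Buz) (zeroʳ c))) Bup (f y)))))
              (trans (B-+•ʳ p y (f y) p) (trans (cong₂ (λ b e → b + f y * e) Bpy (B-alternating p))
                (solve 1 (λ b → :1 :+ b :* :0 := :1) refl (f y)))))
            where
            y : V
            y = c • z
            Bpy : B p y ≡ 1#
            Bpy = trans (B-•ʳ c p z) (trans (*-comm c _) eq)
            s∈S : y +ᵛ f y • p ∈ ∣ solid x ∣
            s∈S = +-closed (solid x) (•-closed (solid x) c z∈S) (•-closed (solid x) (f y) p∈S)
        -- The combination `B u h • z +ᵛ B u z • h` is killed by `B u`, hence by `B p`; with
        -- `B p h ≡ 1#` this is the proportionality.
        ⊥S : ∀ {z} → z ∈ ∣ solid x ∣ → B (u +ᵛ B u h • p) z ≡ 0#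
        ⊥S {z} z∈S = begin
          B (u +ᵛ B u h • p) z                  ≡⟨ B-+ˡ u _ z ⟩
          B u z + B (B u h • p) z               ≡⟨ cong (B u z +_) (B-•ˡ (B u h) p z) ⟩
          B u z + B u h * B p z                 ≡⟨ solve 3 (λ a m b → a :+ m :* b := m :* b :+ a :* :1) refl
                                                     (B u z) (B u h) (B p z) ⟩
          B u h * B p z + B u z * 1#            ≡⟨ cong₂ (λ x y → x + B u z * y) (B-•ʳ (B u h) p z) Bph ⟨
          B p (B u h • z) + B u z * B p h       ≡⟨ B-+•ʳ p _ (B u z) h ⟨
          B p (B u h • z +ᵛ B u z • h)          ≡⟨ ⊥u⇒⊥p (+-closed (solid x) (•-closed (solid x) (B u h) z∈S)
                                                       (•-closed (solid x) (B u z) h∈S)) (begin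
            B u (B u h • z +ᵛ B u z • h)          ≡⟨ B-+•ʳ u _ (B u z) h ⟩
            B u (B u h • z) + B u z * B u h       ≡⟨ cong (_+ B u z * B u h) (B-•ʳ (B u h) u z) ⟩
            B u h * B u z + B u z * B u h         ≡⟨ solve 2 (λ a b → a :* b :+ b :* a := :0) refl (B u h) (B u z) ⟩
            0#                                    ∎) ⟩
          0#                                    ∎

  -- Every elliptic solid is the solid of an affine vector.

  module EllipticSolid (S : Subspace) (S-elliptic : IsEllipticSolid S) where
    open IsEllipticSolid S-elliptic

    opaque
      radical : ∀ {r} → r ∈ ∣ S ∣ → (∀ {w} → w ∈ ∣ S ∣ → B r w ≡ 0#) → r ≡ 0ᵛ
      radical = even-radical 1 {S} dimension nonDegenerate

    opaque
      singular-vector : ∃ λ p → p ∈ ∣ S ∣ × p ≢ 0ᵛ × f p ≡ 0#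
      singular-vector with T , T⊆S , ts , T-dim ← HasWittIndexOn.attained wittIndex
        with p , p∈T , p≢0 ← HasDim-nonzero {T} T-dim
        = p , T⊆S p∈T , p≢0 , ts p p∈T

    p : V
    p = proj₁ singular-vector
    p∈S : p ∈ ∣ S ∣
    p∈S = proj₁ (proj₂ singular-vector)
    p≢0 : p ≢ 0ᵛ
    p≢0 = proj₁ (proj₂ (proj₂ singular-vector))
    fp≡0 : f p ≡ 0#
    fp≡0 = proj₂ (proj₂ (proj₂ singular-vector))

    opaque
      p-partner : ∃ λ h → h ∈ ∣ S ∣ × B p h ≡ 1#
      p-partner = partner {S} dimension radical p∈S p≢0

    h : V
    h = proj₁ p-partner
    h∈S : h ∈ ∣ S ∣
    h∈S = proj₁ (proj₂ p-partner)
    Bph≡1 : B p h ≡ 1#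
    Bph≡1 = proj₂ (proj₂ p-partner)
    Bph≢0 : B p h ≢ 0#
    Bph≢0 eq = 0≢1 (trans (sym eq) Bph≡1)

    plane : Subspace
    plane = S ∩⊥ p ∩⊥ h

    opaque
      plane-dim : HasDim plane 2
      plane-dim = HasDim-kernel {S ∩⊥ p} (B-linear h) (HasDim-kernel {S} (B-linear p) dimension h∈S Bph≢0)
        {p} (p∈S , B-alternating p) (Bph≢0 ∘ B-sym-≡)

      plane-radical : ∀ {r} → r ∈ ∣ plane ∣ → (∀ {w} → w ∈ ∣ plane ∣ → B r w ≡ 0#) → r ≡ 0ᵛ
      plane-radical {r} ((r∈S , Bpr) , Bhr) Br = radical r∈S
        (vanishes-on-split S p∈S h∈S Bph≢0 (B-linear r) (B-sym-≡ Bpr) (B-sym-≡ Bhr) Br)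

    opaque
      -- A singular `e` would span with `p` a totally singular line of `S`, against Witt index 1.
      plane-anisotropic : ∀ {e} → e ∈ ∣ plane ∣ → e ≢ 0ᵛ → f e ≢ 0#
      plane-anisotropic {e} ((e∈S , Bpe) , Bhe) e≢0 fe = ℕ.<-irrefl refl
        (HasWittIndexOn.maximal wittIndex (adjoin e ⟨p⟩) 2
          (adjoin-⊆ e ⟨p⟩ S e∈S (adjoin-⊆ p zeroSubspace S p∈S
            (λ (_ , u≡0) → subst (_∈ ∣ S ∣) (sym u≡0) (0-closed S))))
          (TotallySingular-adjoin {⟨p⟩} (TotallySingular-adjoin {zeroSubspace} TotallySingular-zero fp≡0
              (λ (_ , t≡0) → trans (cong (B p) t≡0) (IsLinear.0-homo (B-linear p)))) fe
            (λ (c , _ , eq) → kernel-+•⁻¹ (B-linear e)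
              (trans (cong (B e) eq) (IsLinear.0-homo (B-linear e))) (B-sym-≡ Bpe)))
          (HasDim-adjoin {e} {⟨p⟩} e∉⟨p⟩ (HasDim-adjoin {p} {zeroSubspace} (v∉0 p≢0) HasDim-zero)))
        where
        ⟨p⟩ : Subspace
        ⟨p⟩ = adjoin p zeroSubspace
        e∉⟨p⟩ : e ∉ ∣ ⟨p⟩ ∣
        e∉⟨p⟩ (c , _ , eq) = e≢0 (trans (sym (u+0•v≡u e p)) (trans (cong (λ c → e +ᵛ c • p) (sym c≡0)) eq))
          where
          c≡0 : c ≡ 0#
          c≡0 = +•-kernel-coefficient (B-linear h) Bhe (Bph≢0 ∘ B-sym-≡)
            (trans (cong (B h) eq) (IsLinear.0-homo (B-linear h)))

    opaque
      plane-basis : ∃ λ e → ∃ λ k → (e ∈ ∣ plane ∣ × f e ≡ 1#) × (k ∈ ∣ plane ∣ × B e k ≡ 1#)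
      plane-basis with e , e∈D , e≢0 ← HasDim-nonzero {plane} plane-dim
        with c , fce≡1 ← f-scale-to-1 {e} (plane-anisotropic e∈D e≢0)
        with ce∈D ← •-closed plane c e∈D
        with k , k∈D , eq ← partner {plane} plane-dim plane-radical ce∈D
               (λ ce≡0 → 0≢1 (trans (sym f-0) (trans (cong f (sym ce≡0)) fce≡1)))
        = c • e , k , (ce∈D , fce≡1) , (k∈D , eq)

    e k : V
    e = proj₁ plane-basis
    k = proj₁ (proj₂ plane-basis)
    e∈D : e ∈ ∣ plane ∣
    e∈D = proj₁ (proj₁ (proj₂ (proj₂ plane-basis)))
    fe≡1 : f e ≡ 1#
    fe≡1 = proj₂ (proj₁ (proj₂ (proj₂ plane-basis)))
    k∈D : k ∈ ∣ plane ∣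
    k∈D = proj₁ (proj₂ (proj₂ (proj₂ plane-basis)))
    Bek≡1 : B e k ≡ 1#
    Bek≡1 = proj₂ (proj₂ (proj₂ (proj₂ plane-basis)))
    Bek≢0 : B e k ≢ 0#
    Bek≢0 eq = 0≢1 (trans (sym eq) Bek≡1)
    e∈S : e ∈ ∣ S ∣
    e∈S = proj₁ (proj₁ e∈D)
    k∈S : k ∈ ∣ S ∣
    k∈S = proj₁ (proj₁ k∈D)

    opaque
      -- Since `f (k +ᵛ s • e)` equals `f k + ℘ s`, a solution would make this vector singular; it
      -- is nonzero because its product with `e` is 1.
      fk∉℘ : ∀ s → ℘ s ≢ f k
      fk∉℘ s eq = plane-anisotropic (+-closed plane k∈D (•-closed plane s e∈D))
        (λ z≡0 → Bek≢0 (begin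
          B e k                  ≡⟨ solve 2 (λ b s → b := b :+ s :* :0) refl (B e k) s ⟩
          B e k + s * 0#         ≡⟨ cong (λ b → B e k + s * b) (B-alternating e) ⟨
          B e k + s * B e e      ≡⟨ B-+•ʳ e k s e ⟨
          B e (k +ᵛ s • e)       ≡⟨ cong (B e) z≡0 ⟩
          B e 0ᵛ                 ≡⟨ IsLinear.0-homo (B-linear e) ⟩
          0#                     ∎))
        (begin
          f (k +ᵛ s • e)                   ≡⟨ f-+• k s e ⟩
          f k + s * s * f e + s * B k e    ≡⟨ cong₂ (λ a b → f k + s * s * a + s * b) fe≡1 (B-sym-≡ Bek≡1) ⟩
          f k + s * s * 1# + s * 1#        ≡⟨ cong (λ a → a + s * s * 1# + s * 1#) eq ⟨
          ℘ s + s * s * 1# + s * 1#        ≡⟨ solve 1 (λ s → s :* s :+ s :+ s :* s :* :1 :+ s :* :1 := :0) refl s ⟩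
          0#                               ∎)

    opaque
      vanishes-on-S : ∀ {g} → IsLinear g → g p ≡ 0# → g h ≡ 0# → g e ≡ 0# → g k ≡ 0# →
                      ∀ {u} → u ∈ ∣ S ∣ → g u ≡ 0#
      vanishes-on-S {g} lin gp gh ge gk = vanishes-on-split S p∈S h∈S Bph≢0 lin gp gh
        (vanishes-on-split plane e∈D k∈D Bek≢0 lin ge gk zero-case)
        where
        zero-case : ∀ {u} → u ∈ ∣ plane ∩⊥ e ∩⊥ k ∣ → g u ≡ 0#
        zero-case {u} u∈ with _ , _ , ⊆0 , _ ← HasDim-kernel {plane ∩⊥ e} (B-linear k)
            (HasDim-kernel {plane} (B-linear e) plane-dim k∈D Bek≢0)
            {e} (e∈D , B-alternating e) (Bek≢0 ∘ B-sym-≡)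
          = trans (cong g (proj₂ (⊆0 {u} u∈))) (IsLinear.0-homo lin)

    opaque
      -- A vector with product 1 with `ν` is made orthogonal first to `p` and `h`, then to `e` and
      -- `k`. These all lie in `H₀`, so the product with `ν` stays 1.
      S-perp : ∃ λ a → B ν a ≡ 1# × (∀ {u} → u ∈ ∣ S ∣ → B a u ≡ 0#)
      S-perp = by ν-partner
        where
        by : (∃ λ a → B ν a ≡ 1#) → ∃ λ a → B ν a ≡ 1# × (∀ {u} → u ∈ ∣ S ∣ → B a u ≡ 0#)
        by (a , Bνa) = a₂ , ν₂ , vanishes-on-S (B-linear a₂)
          (B-sym-≡ (+•-kernel (B-linear p) (+•-kernel (B-linear p) (proj₁ o₁) (proj₂ (proj₁ e∈D)) _) (proj₂ (proj₁ k∈D)) _))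
          (B-sym-≡ (+•-kernel (B-linear h) (+•-kernel (B-linear h) (proj₂ o₁) (proj₂ e∈D) _) (proj₂ k∈D) _))
          (B-sym-≡ (proj₁ o₂)) (B-sym-≡ (proj₂ o₂))
          where
          a₁ a₂ : V
          a₁ = a +ᵛ B h a • p +ᵛ B p a • h
          a₂ = a₁ +ᵛ B k a₁ • e +ᵛ B e a₁ • k
          o₁ : B p a₁ ≡ 0# × B h a₁ ≡ 0#
          o₁ = orthogonalise Bph≡1 a
          o₂ : B e a₂ ≡ 0# × B k a₂ ≡ 0#
          o₂ = orthogonalise Bek≡1 a₁
          +S : ∀ {b s} → B ν b ≡ 1# → s ∈ ∣ S ∣ → ∀ c → B ν (b +ᵛ c • s) ≡ 1#
          +S {b} {s} Bνb s∈S c = trans (B-+•ʳ ν b c s) (trans (cong₂ (λ x y → x + c * y) Bνb (ν⊥H₀ (inside s∈S)))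
            (solve 1 (λ c → :1 :+ c :* :0 := :1) refl c))
          ν₂ : B ν a₂ ≡ 1#
          ν₂ = +S (+S (+S (+S Bνa p∈S _) h∈S _) e∈S _) k∈S _

    opaque
      f-+ν : ∀ {a} → B ν a ≡ 1# → ∀ s → f (a +ᵛ s • ν) ≡ f a + ℘ s
      f-+ν {a} Bνa s = trans (f-+• a s ν) (trans (cong₂ (λ x y → f a + s * s * x + s * y) fν≡1 (B-sym-≡ Bνa))
        (solve 2 (λ a s → a :+ s :* s :* :1 :+ s :* :1 := a :+ (s :* s :+ s)) refl (f a) s))

    -- If a is orthogonal to S with B ν a = 1 and f a = f k, the planes ⟨e, k⟩ and ⟨ν, a⟩ are isometric,
    -- so their sum contains the totally singular plane ⟨ν + e, a + k⟩, orthogonal to the singular vector p.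
    opaque
      no-isometric-plane : ∀ {a} → B ν a ≡ 1# → (∀ {u} → u ∈ ∣ S ∣ → B a u ≡ 0#) → f a ≢ f k
      -- Maximality of the totally singular line `T` puts `a +ᵛ k` on it, while `T` lies in the perp
      -- of `ν` and `a +ᵛ k` does not.
      no-isometric-plane {a} Bνa a⊥S fa≡fk = 0≢1 (trans (sym (T⊆H₀ m∈T)) (begin
          B ν (a +ᵛ k)      ≡⟨ B-+ʳ ν a k ⟩
          B ν a + B ν k     ≡⟨ cong₂ _+_ Bνa (ν⊥H₀ (inside k∈S)) ⟩
          1# + 0#           ≡⟨ +-identityʳ 1# ⟩
          1#                ∎))
        where
        ⟨p⟩ T : Subspace
        ⟨p⟩ = adjoin p zeroSubspace
        T = adjoin (ν +ᵛ e) ⟨p⟩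
        m n : V
        m = a +ᵛ k
        n = ν +ᵛ e
        ⟨p⟩-vanish : ∀ {g} → IsLinear g → g p ≡ 0# → ∀ {u} → u ∈ ∣ ⟨p⟩ ∣ → g u ≡ 0#
        ⟨p⟩-vanish {g} lin gp (c , _ , eq) = kernel-+•⁻¹ lin (trans (cong g eq) (IsLinear.0-homo lin)) gp
        T-vanish : ∀ {g} → IsLinear g → g p ≡ 0# → g n ≡ 0# → ∀ {u} → u ∈ ∣ T ∣ → g u ≡ 0#
        T-vanish lin gp gn (c , u∈) = kernel-+•⁻¹ lin (⟨p⟩-vanish lin gp u∈) gn
        Bnp : B n p ≡ 0#
        Bnp = trans (B-+ˡ ν e p) (trans (cong₂ _+_ (ν⊥H₀ (inside p∈S)) (B-sym-≡ (proj₂ (proj₁ e∈D)))) (+-identityˡ 0#))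
        Bnk : B n k ≡ 1#
        Bnk = trans (B-+ˡ ν e k) (trans (cong₂ _+_ (ν⊥H₀ (inside k∈S)) Bek≡1) (+-identityˡ 1#))
        Bνn : B ν n ≡ 0#
        Bνn = ν⊥H₀ (+-closed H₀ ν∈H₀ (inside e∈S))
        fn : f n ≡ 0#
        fn = trans (f-+ ν e) (trans (cong₂ _+_ (cong₂ _+_ fν≡1 fe≡1) (ν⊥H₀ (inside e∈S)))
          (solve 0 (:1 :+ :1 :+ :0 := :0) refl))
        fm : f m ≡ 0#
        fm = trans (f-+ a k) (trans (cong₂ _+_ (cong (_+ f k) fa≡fk) (a⊥S k∈S))
          (solve 1 (λ x → x :+ x :+ :0 := :0) refl (f k)))
        Bmn : B m n ≡ 0#
        Bmn = begin
          B m n                                ≡⟨ B-+ʳ m ν e ⟩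
          B m ν + B m e                        ≡⟨ cong₂ _+_ (B-+ˡ a k ν) (B-+ˡ a k e) ⟩
          B a ν + B k ν + (B a e + B k e)      ≡⟨ cong₂ _+_ (cong₂ _+_ (B-sym-≡ Bνa) (B-sym-≡ (ν⊥H₀ (inside k∈S))))
                                                    (cong₂ _+_ (a⊥S e∈S) (B-sym-≡ Bek≡1)) ⟩
          1# + 0# + (0# + 1#)                  ≡⟨ solve 0 (:1 :+ :0 :+ (:0 :+ :1) := :0) refl ⟩
          0#                                   ∎
        Bmp : B m p ≡ 0#
        Bmp = trans (B-+ˡ a k p) (trans (cong₂ _+_ (a⊥S p∈S) (B-sym-≡ (proj₂ (proj₁ k∈D)))) (+-identityˡ 0#))
        ⟨p⟩-ts : TotallySingular f ⟨p⟩
        ⟨p⟩-ts = TotallySingular-adjoin {zeroSubspace} TotallySingular-zero fp≡0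
          (λ (_ , t≡0) → trans (cong (B p) t≡0) (IsLinear.0-homo (B-linear p)))
        T-dim : HasDim T 2
        T-dim = HasDim-adjoin {n} {⟨p⟩}
          (λ n∈⟨p⟩ → 0≢1 (trans (sym (⟨p⟩-vanish (B-linear k) (B-sym-≡ (Bpk)) n∈⟨p⟩)) (B-sym-≡ Bnk)))
          (HasDim-adjoin {p} {zeroSubspace} (v∉0 p≢0) HasDim-zero)
          where
          Bpk : B p k ≡ 0#
          Bpk = proj₂ (proj₁ k∈D)
        m∈T : m ∈ ∣ T ∣
        m∈T = maximal-TotallySingular {T} T-dim
          (TotallySingular-adjoin {⟨p⟩} ⟨p⟩-ts fn (⟨p⟩-vanish (B-linear n) Bnp)) fm
          (T-vanish (B-linear m) Bmp Bmn)
        T⊆H₀ : ∀ {u} → u ∈ ∣ T ∣ → B ν u ≡ 0#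
        T⊆H₀ = T-vanish (B-linear ν) (ν⊥H₀ (inside p∈S)) Bνn

    opaque
      apex : ∃ λ x → Affine x × ∣ S ∣ ≐ ∣ solid x ∣
      apex with a , Bνa , a⊥S ← S-perp = by (image-℘-index-2 fk∉℘ (f a))
        where
        +ν-⊥S : ∀ s {u} → u ∈ ∣ S ∣ → B u (a +ᵛ s • ν) ≡ 0#
        +ν-⊥S s {u} u∈S = +•-kernel (B-linear u) (B-sym-≡ (a⊥S u∈S)) (B-sym-≡ (ν⊥H₀ (inside u∈S))) s
        +ν-ν : ∀ s → B ν (a +ᵛ s • ν) ≡ 1#
        +ν-ν s = trans (B-+•ʳ ν a s ν) (trans (cong₂ (λ x y → x + s * y) Bνa (B-alternating ν))
          (solve 1 (λ s → :1 :+ s :* :0 := :1) refl s))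
        by : (∃ λ s → ℘ s ≡ f a ⊎ ℘ s ≡ f a + f k) → ∃ λ x → Affine x × ∣ S ∣ ≐ ∣ solid x ∣
        by (s , inj₁ eq) = x , ax , S⊆ , ⊆∧dim⇒⊇ {S} {solid x} dimension (solid-dim ax) S⊆
          where
          x : V
          x = a +ᵛ s • ν
          ax : Affine x
          ax = affine (trans (f-+ν Bνa s) (trans (cong (f a +_) eq) (x+x≡0 (f a)))) (+ν-ν s)
          S⊆ : ∣ S ∣ ⊆ ∣ solid x ∣
          S⊆ u∈S = inside u∈S , B-sym-≡ (+ν-⊥S s u∈S)
        -- In this case `f (a +ᵛ s • ν)` equals `f k`.
        by (s , inj₂ eq) = contradiction (trans (f-+ν Bνa s) (trans (cong (f a +_) eq)
            (solve 2 (λ a k → a :+ (a :+ k) := k) refl (f a) (f k))))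
          (no-isometric-plane (+ν-ν s) (λ u∈S → B-sym-≡ (+ν-⊥S s u∈S)))

-- Counting in setoids.

module _ {a ℓ : Level} (S : Setoid a ℓ) where
  open Setoid S using (Carrier; _≈_) renaming (sym to ≈-sym; trans to ≈-trans)

  module Size {k : ℕ} (size : HasSize S k) where
    open Inverse size public using () renaming (to to number; from to member; to-cong to number-cong)

    number-member : ∀ i → number (member i) ≡ i
    number-member = Inverse.strictlyInverseˡ size

    member-number : ∀ x → member (number x) ≈ x
    member-number = Inverse.strictlyInverseʳ size

    number-injective : ∀ {x y} → number x ≡ number y → x ≈ y
    number-injective {x} {y} eq =
      ≈-trans (≈-sym (member-number x)) (≈-trans (Inverse.from-cong size eq) (member-number y))

  two-elements : ∀ {x y} → ¬ (x ≈ y) → (∀ z → z ≈ x ⊎ z ≈ y) → HasSize S 2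
  two-elements {x} {y} x≉y cases = record
    { to        = λ z → number (cases z)
    ; from      = member
    ; to-cong   = λ {z} {w} → number-cong (cases z) (cases w)
    ; from-cong = λ { refl → Setoid.refl S }
    ; inverse   = (λ {i} {z} → inverseˡ i (cases z)) , λ { {z} refl → inverseʳ (cases z) }
    }
    where
    number : ∀ {z} → z ≈ x ⊎ z ≈ y → Fin 2
    number (inj₁ _) = zero
    number (inj₂ _) = suc zero
    member : Fin 2 → Carrier
    member zero       = x
    member (suc zero) = y
    number-cong : ∀ {z w} (c : z ≈ x ⊎ z ≈ y) (e : w ≈ x ⊎ w ≈ y) → z ≈ w → number c ≡ number e
    number-cong (inj₁ _) (inj₁ _) _ = refl
    number-cong (inj₂ _) (inj₂ _) _ = refl
    number-cong (inj₁ p) (inj₂ r) z≈w = contradiction (≈-trans (≈-sym p) (≈-trans z≈w r)) x≉y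
    number-cong (inj₂ p) (inj₁ r) z≈w = contradiction (≈-trans (≈-sym r) (≈-trans (≈-sym z≈w) p)) x≉y
    inverseˡ : ∀ i {z} (c : z ≈ x ⊎ z ≈ y) → z ≈ member i → number c ≡ i
    inverseˡ zero       (inj₁ _) _   = refl
    inverseˡ (suc zero) (inj₂ _) _   = refl
    inverseˡ zero       (inj₂ p) z≈x = contradiction (≈-trans (≈-sym z≈x) p) x≉y
    inverseˡ (suc zero) (inj₁ p) z≈y = contradiction (≈-trans (≈-sym p) z≈y) x≉y
    inverseʳ : ∀ {z} (c : z ≈ x ⊎ z ≈ y) → member (number c) ≈ z
    inverseʳ (inj₁ p) = ≈-sym p
    inverseʳ (inj₂ p) = ≈-sym p

  opaque
    -- Read through the two numberings, the inclusion is an injection of `Fin k` into itself, hence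
    -- onto.
    ⊆∧size⇒⊇ : ∀ {r r′ k} {R : Pred Carrier r} {R′ : Pred Carrier r′} → R Respects _≈_ → R ⊆ R′ →
               HasSize (Sub S R) k → HasSize (Sub S R′) k → R′ ⊆ R
    ⊆∧size⇒⊇ {k = k} {R} {R′} resp R⊆R′ size size′ {x} x∈R′ =
      found (injective⇒surjective {g = g} g-injective (number′ (x , x∈R′)))
      where
      number′ : ∃ R′ → Fin k
      number′ = Inverse.to size′
      member : Fin k → ∃ R
      member = Inverse.from size
      include : ∃ R → ∃ R′
      include (y , y∈R) = y , R⊆R′ y∈R
      g : Fin k → Fin k
      g i = number′ (include (member i))
      reflect : ∀ {y z} → number′ y ≡ number′ z → proj₁ y ≈ proj₁ z
      reflect {y} {z} eq = ≈-trans (≈-sym (Inverse.strictlyInverseʳ size′ y))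
        (≈-trans (Inverse.from-cong size′ eq) (Inverse.strictlyInverseʳ size′ z))
      g-injective : ∀ {i j} → g i ≡ g j → i ≡ j
      g-injective {i} {j} eq = trans (sym (Inverse.strictlyInverseˡ size i))
        (trans (Inverse.to-cong size {member i} {member j} (reflect eq)) (Inverse.strictlyInverseˡ size j))
      found : (∃ λ i → g i ≡ number′ (x , x∈R′)) → R x
      found (i , eq) = resp (reflect eq) (proj₂ (member i))

-- The point map: normalised representatives, twins and ovoids.

module Covering
  {q : ℕ} (F : FiniteField q) (1+1≡0 : Characteristic2 F)
  (f : VectorSpace.V F 6 → FiniteField.Carrier F)
  (isQuadratic : VectorSpace.IsQuadraticForm F 6 f)
  (f-nondeg : VectorSpace.NonDegenerateOn F 6 f (VectorSpace.whole F 6))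
  (f-witt : VectorSpace.HasWittIndexOn F 6 f (VectorSpace.whole F 6) 2)
  (H₀ : VectorSpace.Subspace F 6)
  (H₀-dim : VectorSpace.HasDim F 6 H₀ 5)
  (H₀-nondeg : VectorSpace.NonDegenerateOn F 6 f H₀) where
  open FiniteField F
  open VectorSpace F 6
  open Configuration F 1+1≡0 f isQuadratic f-nondeg f-witt H₀ H₀-dim H₀-nondeg
  open Affine
  open ≡-Reasoning

  opaque
    ∼-intro : ∀ {u v} (u≢0 : u ≢ 0ᵛ) (v≢0 : v ≢ 0ᵛ) c → u ≡ c • v → (u , u≢0) ∼ (v , v≢0)
    ∼-intro {u} {v} u≢0 v≢0 c eq = by (inverse c λ c≡0 → u≢0 (trans eq (trans (cong (_• v) c≡0) (0•v≡0 v))))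
      where
      •-• : ∀ a b → a • b • v ≡ (a * b) • v
      •-• a b = coordinatewise (a ⊙ b ⊙ 𝟎) ((a * b) ⊙ 𝟎) (λ { (x ∷ []) → sym (*-assoc a b x) }) (v ∷ [])
      by : (∃ λ b → c * b ≡ 1#) → (u , u≢0) ∼ (v , v≢0)
      by (b , cb≡1) = (λ (a , w≡) → a * c , trans w≡ (trans (cong (a •_) eq) (•-• a c)))
        , λ (a , w≡) → a * b , trans w≡ (begin
          a • v               ≡⟨ cong (a •_) (•-•-inverse c b v cb≡1) ⟨
          a • b • c • v       ≡⟨ cong (λ w → a • b • w) eq ⟨
          a • b • u           ≡⟨ coordinatewise (a ⊙ b ⊙ 𝟎) ((a * b) ⊙ 𝟎)
                                   (λ { (x ∷ []) → sym (*-assoc a b x) }) (u ∷ []) ⟩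
          (a * b) • u         ∎)

    ∼-elim : ∀ {x y} → x ∼ y → ∃ λ c → proj₁ x ≡ c • proj₁ y
    ∼-elim {x} (x⊆y , _) = x⊆y (1# , sym (•-identityˡ (proj₁ x)))

  affine≢0 : ∀ {x} → Affine x → x ≢ 0ᵛ
  affine≢0 ax x≡0 = ∉H₀ ax (subst (_∈ ∣ H₀ ∣) (sym x≡0) (0-closed H₀))

  point : ∀ {x} → Affine x → AffinePoint
  point {x} ax = (x , affine≢0 ax) , singular ax , λ (_ , x∈H₀) → ∉H₀ ax x∈H₀

  opaque
    affine-multiple : ∀ {x y} → Affine x → Affine y → ∀ c → y ≡ c • x → y ≡ x
    affine-multiple {x} {y} ax ay c eq = trans eq (trans (cong (_• x) c≡1) (•-identityˡ x))
      where
      c≡1 : c ≡ 1#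
      c≡1 = begin
        c              ≡⟨ *-identityʳ c ⟨
        c * 1#         ≡⟨ cong (c *_) (ν-value ax) ⟨
        c * B ν x      ≡⟨ B-•ʳ c ν x ⟨
        B ν (c • x)    ≡⟨ cong (B ν) eq ⟨
        B ν y          ≡⟨ ν-value ay ⟩
        1#             ∎

    normalise : ∀ {v} → f v ≡ 0# → v ∉ ∣ H₀ ∣ → ∃ λ x → Affine x × ∃ λ c → x ≡ c • v
    normalise {v} fv v∉H₀ with c , eq ← inverse (B ν v) (λ νv → v∉H₀ (⊥ν⇒∈H₀ νv)) =
      c • v , affine (f-•≡0 fv c) (trans (B-•ʳ c ν v) (trans (*-comm c _) eq)) , c , refl

  module _ (a : AffinePoint) where
    private
      v : V
      v = proj₁ (proj₁ a)

    opaque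
      normal-form : ∃ λ x → Affine x × ∃ λ c → x ≡ c • v
      normal-form = normalise (proj₁ (proj₂ a)) λ v∈H₀ → proj₂ (proj₂ a) (proj₁ (proj₂ a) , v∈H₀)

    rep : V
    rep = proj₁ normal-form

    rep-affine : Affine rep
    rep-affine = proj₁ (proj₂ normal-form)

    rep-∼ : (rep , affine≢0 rep-affine) ∼ proj₁ a
    rep-∼ = ∼-intro (affine≢0 rep-affine) (proj₂ (proj₁ a)) (proj₁ (proj₂ (proj₂ normal-form))) (proj₂ (proj₂ (proj₂ normal-form)))

    opaque
      rep-unique : ∀ {x} (ax : Affine x) → (x , affine≢0 ax) ∼ proj₁ a → rep ≡ x
      rep-unique {x} ax x∼a = by (∼-elim {rep , affine≢0 rep-affine} {x , affine≢0 ax}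
          (≐-trans rep-∼ (≐-sym x∼a)))
        where
        by : (∃ λ c → rep ≡ c • x) → rep ≡ x
        by (c , eq) = affine-multiple ax rep-affine c eq

    opaque
      rep-∈ : ∀ W → v ∈ ∣ W ∣ → rep ∈ ∣ W ∣
      rep-∈ W = pts-resp W {proj₁ a} {rep , affine≢0 rep-affine} (≐-sym rep-∼)

      ∈-rep : ∀ W → rep ∈ ∣ W ∣ → v ∈ ∣ W ∣
      ∈-rep W = pts-resp W {rep , affine≢0 rep-affine} {proj₁ a} rep-∼

    opaque
      φ₀-pt≐solid : φ₀-pt a ≐ (pts (solid rep) ∩ Q₀)
      φ₀-pt≐solid = (λ {z} (Bvz , fz , z∈H₀) → (z∈H₀ , B-sym-≡ (proj₂ (rep-∈ (zᗮ z) (_ , B-sym-≡ Bvz)))) , fz , z∈H₀)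
                  , λ {z} ((z∈H₀ , Bxz) , fz , _) → B-sym-≡ (proj₂ (∈-rep (zᗮ z) (_ , B-sym-≡ Bxz))) , fz , z∈H₀
        where
        -- Orthogonality to `z` is phrased as membership in a subspace, which passes to proportional
        -- vectors.
        zᗮ : ProjPoint → Subspace
        zᗮ (z , _) = whole ∩⊥ z

  rep-point : ∀ {x} (ax : Affine x) → rep (point ax) ≡ x
  rep-point ax = rep-unique (point ax) ax ≐-refl

  module _ (a b : AffinePoint) where
    opaque
      rep≡⇒∼ : rep a ≡ rep b → proj₁ a ∼ proj₁ b
      rep≡⇒∼ eq = ≐-trans (≐-sym (rep-∼ a)) (≐-trans
        (∼-intro (affine≢0 (rep-affine a)) (affine≢0 (rep-affine b)) 1# (trans eq (sym (•-identityˡ (rep b))))) (rep-∼ b))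

      ∼⇒rep≡ : proj₁ a ∼ proj₁ b → rep a ≡ rep b
      ∼⇒rep≡ a∼b = rep-unique a (rep-affine b) (≐-trans (rep-∼ b) (≐-sym a∼b))

    opaque
      rep≡⇒φ≐ : rep a ≡ rep b → φ₀-pt a ≐ φ₀-pt b
      rep≡⇒φ≐ eq = ≐-trans (φ₀-pt≐solid a) (≐-trans
        (subst (λ x → (pts (solid (rep a)) ∩ Q₀) ≐ (pts (solid x) ∩ Q₀)) eq ≐-refl) (≐-sym (φ₀-pt≐solid b)))

      -- `ν` is orthogonal to `H₀`, so twins have the same perp inside `H₀`.
      rep-twin⇒φ≐ : rep a ≡ rep b +ᵛ ν → φ₀-pt a ≐ φ₀-pt b
      rep-twin⇒φ≐ eq = ≐-trans (φ₀-pt≐solid a) (≐-trans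
        ( (λ {z} ((z∈H₀ , Baz) , r) → (z∈H₀ , trans (sym (same z z∈H₀)) Baz) , r)
        , (λ {z} ((z∈H₀ , Bbz) , r) → (z∈H₀ , trans (same z z∈H₀) Bbz) , r))
        (≐-sym (φ₀-pt≐solid b)))
        where
        same : ∀ (z : ProjPoint) → proj₁ z ∈ ∣ H₀ ∣ → B (rep a) (proj₁ z) ≡ B (rep b) (proj₁ z)
        same (z , _) z∈H₀ = trans (cong (λ x → B x z) eq) (trans (B-+ˡ (rep b) ν z)
          (trans (cong (B (rep b) z +_) (ν⊥H₀ z∈H₀)) (+-identityʳ _)))

    opaque
      φ⊆⇒rep : φ₀-pt a ⊆ φ₀-pt b → rep b ≡ rep a ⊎ rep b ≡ rep a +ᵛ ν
      φ⊆⇒rep φa⊆φb = same-ovoid (rep-affine a) (rep-affine b) ⊥b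
        where
        ⊥b : ∀ {z} → z ∈ ∣ solid (rep a) ∣ → f z ≡ 0# → B (rep b) z ≡ 0#
        ⊥b {z} z∈S fz with z ≟ᵛ 0ᵛ
        -- The zero vector is no projective point, so the inclusion of ovoids says nothing about it.
        ... | yes z≡0 = trans (cong (B (rep b)) z≡0) (IsLinear.0-homo (B-linear (rep b)))
        ... | no  z≢0 = proj₂ (proj₁ (proj₁ (φ₀-pt≐solid b) {z , z≢0}
              (φa⊆φb {z , z≢0} (proj₂ (φ₀-pt≐solid a) {z , z≢0} (z∈S , fz , proj₁ z∈S)))))

    opaque
      -- The inclusion leaves only `rep a` and its twin for `rep b`, and the twin is not orthogonal
      -- to `rep a`.
      φ⊆∧⊥⇒∼ : φ₀-pt a ⊆ φ₀-pt b → B (rep a) (rep b) ≡ 0# → proj₁ b ∼ proj₁ a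
      φ⊆∧⊥⇒∼ φ⊆ Bab = by (φ⊆⇒rep (λ {z} → φ⊆ {z}))
        where
        by : rep b ≡ rep a ⊎ rep b ≡ rep a +ᵛ ν → proj₁ b ∼ proj₁ a
        by (inj₁ eq) = ≐-trans (≐-sym (rep-∼ b)) (≐-trans
          (∼-intro (affine≢0 (rep-affine b)) (affine≢0 (rep-affine a)) 1# (trans eq (sym (•-identityˡ (rep a))))) (rep-∼ a))
        by (inj₂ eq) = contradiction (trans (sym Bab) (trans (cong (B (rep a)) eq)
          (twin-not-⊥ (rep-affine a)))) 0≢1

  ovoid : ∀ a → IsEllipticOvoid (φ₀-pt a)
  ovoid a = solid (rep a) , solid-elliptic (rep-affine a) , φ₀-pt≐solid a

  φ : AffinePoint → Ovoid
  φ a = φ₀-pt a , ovoid a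

  opaque
    φ-surjective : ∀ (X : Ovoid) → ∃ λ x → Σ (Affine x) λ ax → φ (point ax) ≈ᴼ X
    φ-surjective (X , S , S-elliptic , X≐) = by (EllipticSolid.apex S S-elliptic)
      where
      by : (∃ λ x → Affine x × ∣ S ∣ ≐ ∣ solid x ∣) → ∃ λ x → Σ (Affine x) λ ax → φ (point ax) ≈ᴼ (X , S , S-elliptic , X≐)
      by (x , ax , S⊆ , ⊆S) = x , ax , ≐-trans (φ₀-pt≐solid (point ax)) (≐-trans
        ( (λ {z} (z∈ , r) → ⊆S (subst (λ x → proj₁ z ∈ ∣ solid x ∣) (rep-point ax) z∈) , r)
        , (λ {z} (z∈ , r) → subst (λ x → proj₁ z ∈ ∣ solid x ∣) (sym (rep-point ax)) (S⊆ z∈) , r))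
        (≐-sym X≐))

  -- The image of an affine line is a rosette.

  module _ (l : AffineLine) where
    private
      L : Subspace
      L = line l
      L-dim : HasDim L 2
      L-dim = AffineLine.dimension l
      L-ts : TotallySingular f L
      L-ts = AffineLine.totallySingular l

    opaque
      affine-on-line : ∃ λ x → Affine x × x ∈ ∣ L ∣
      affine-on-line = by (vanishes? {L} (B-linear ν) L-dim)
        where
        by : (∃ λ w → w ∈ ∣ L ∣ × B ν w ≢ 0#) ⊎ (∀ {w} → w ∈ ∣ L ∣ → B ν w ≡ 0#) → ∃ λ x → Affine x × x ∈ ∣ L ∣
        by (inj₂ νL≡0) = contradiction (λ {z} z∈L → L-ts _ z∈L , ⊥ν⇒∈H₀ (νL≡0 z∈L)) (AffineLine.notInQ₀ l)
        by (inj₁ (w , w∈L , νw≢0)) with x , ax , c , eq ← normalise (L-ts w w∈L) (λ w∈H₀ → νw≢0 (ν⊥H₀ w∈H₀)) =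
          x , ax , subst (_∈ ∣ L ∣) (sym eq) (•-closed L c w∈L)

      at-infinity : ∃ λ p → p ∈ ∣ L ∩⊥ ν ∣ × p ≢ 0ᵛ
      at-infinity = nonzero-in-kernel {L} (B-linear ν) L-dim

    origin : V
    origin = proj₁ affine-on-line
    origin-affine : Affine origin
    origin-affine = proj₁ (proj₂ affine-on-line)
    origin∈L : origin ∈ ∣ L ∣
    origin∈L = proj₂ (proj₂ affine-on-line)

    p∞ : V
    p∞ = proj₁ at-infinity
    p∞∈L : p∞ ∈ ∣ L ∣
    p∞∈L = proj₁ (proj₁ (proj₂ at-infinity))
    p∞∈H₀ : p∞ ∈ ∣ H₀ ∣
    p∞∈H₀ = ⊥ν⇒∈H₀ (proj₂ (proj₁ (proj₂ at-infinity)))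
    p∞≢0 : p∞ ≢ 0ᵛ
    p∞≢0 = proj₂ (proj₂ at-infinity)

    P∞ : ProjPoint
    P∞ = p∞ , p∞≢0

    opaque
      -- `L ∩⊥ ν` has dimension 1, as `origin` is not in it, and is therefore spanned by `p∞`.
      line∩H₀ : ∀ {z} → z ∈ ∣ L ∣ → z ∈ ∣ H₀ ∣ → ∃ λ c → z ≡ c • p∞
      line∩H₀ {z} z∈L z∈H₀ = by (⊆∧dim⇒⊇ {adjoin p∞ zeroSubspace} {L ∩⊥ ν}
          (HasDim-adjoin {p∞} {zeroSubspace} (v∉0 p∞≢0) HasDim-zero)
          (HasDim-kernel {L} (B-linear ν) L-dim origin∈L (λ eq → 0≢1 (trans (sym eq) (ν-value origin-affine))))
          (adjoin-⊆ p∞ zeroSubspace (L ∩⊥ ν) (proj₁ (proj₂ at-infinity))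
            (λ (_ , u≡0) → subst (_∈ ∣ L ∩⊥ ν ∣) (sym u≡0) (0-closed (L ∩⊥ ν))))
          (z∈L , ν⊥H₀ z∈H₀))
        where
        by : z ∈ ∣ adjoin p∞ zeroSubspace ∣ → ∃ λ c → z ≡ c • p∞
        by (c , _ , eq) = c , u+v≡0⇒u≡v eq

    opaque
      -- Normalised vectors have the same product with `ν`, so the difference of two of them on `L`
      -- lies in `H₀`. Thus the affine points of the line are parametrised by the field.
      line-coordinate : ∀ {x} → Affine x → x ∈ ∣ L ∣ → ∀ {y} → Affine y → y ∈ ∣ L ∣ → ∃ λ c → y ≡ x +ᵛ c • p∞
      line-coordinate {x} ax x∈L {y} ay y∈L = by (line∩H₀ (+-closed L y∈L x∈L)
          (⊥ν⇒∈H₀ (trans (B-+ʳ ν y x) (trans (cong₂ _+_ (ν-value ay) (ν-value ax)) (x+x≡0 1#)))))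
        where
        by : (∃ λ c → y +ᵛ x ≡ c • p∞) → ∃ λ c → y ≡ x +ᵛ c • p∞
        by (c , eq) = c , trans (sym (u+v+v≡u y x)) (trans (cong (_+ᵛ x) eq) (+ᵛ-comm _ x))

    opaque
      vanishes-on-line : ∀ {g} → IsLinear g → ∀ {x} → Affine x → x ∈ ∣ L ∣ → g x ≡ 0# → g p∞ ≡ 0# →
                         ∀ {z} → z ∈ ∣ L ∣ → g z ≡ 0#
      vanishes-on-line {g} lin {x} ax x∈L gx gp {z} z∈L
        with c , eq ← kernel-projection (B-linear ν) (λ νx → 0≢1 (trans (sym νx) (ν-value ax))) z
        with e , eq′ ← line∩H₀ (+-closed L z∈L (•-closed L c x∈L)) (⊥ν⇒∈H₀ eq)
        = kernel-+•⁻¹ lin (trans (cong g eq′) (trans (IsLinear.•-homo lin e p∞)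
            (trans (cong (e *_) gp) (zeroʳ e)))) gx

    opaque
      translate-affine : ∀ c → Affine (origin +ᵛ c • p∞)
      translate-affine c = affine
        (L-ts _ (+-closed L origin∈L (•-closed L c p∞∈L)))
        (trans (B-+•ʳ ν origin c p∞) (trans (cong₂ (λ x y → x + c * y) (ν-value origin-affine) (ν⊥H₀ p∞∈H₀))
          (solve 1 (λ c → :1 :+ c :* :0 := :1) refl c)))

    translate-∈ : ∀ c → origin +ᵛ c • p∞ ∈ ∣ L ∣
    translate-∈ c = +-closed L origin∈L (•-closed L c p∞∈L)

    opaque
      translate-injective : ∀ {c e} → origin +ᵛ c • p∞ ≡ origin +ᵛ e • p∞ → c ≡ e
      translate-injective {c} {e} eq = x+y≡0⇒x≡y (c•v≡0⇒c≡0 p∞≢0 (begin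
        (c + e) • p∞
          ≡⟨ coordinatewise ((c + e) ⊙ 𝟏) (𝟎 ⊕ c ⊙ 𝟏 ⊕ (𝟎 ⊕ e ⊙ 𝟏)) (λ { (x ∷ y ∷ []) →
               solve 4 (λ c e x y → (c :+ e) :* y := x :+ c :* y :+ (x :+ e :* y)) refl c e x y })
               (origin ∷ p∞ ∷ []) ⟩
        origin +ᵛ c • p∞ +ᵛ (origin +ᵛ e • p∞)  ≡⟨ cong (_+ᵛ _) eq ⟩
        origin +ᵛ e • p∞ +ᵛ (origin +ᵛ e • p∞)  ≡⟨ v+v≡0 _ ⟩
        0ᵛ                                      ∎))

    hat-point : ∀ {x} (ax : Affine x) → x ∈ ∣ L ∣ → proj₁ (point ax) ∈ hat l
    hat-point ax x∈L = x∈L , λ (_ , _ , x∈H₀) → ∉H₀ ax x∈H₀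

    opaque
      rep-on-line : ∀ a → proj₁ a ∈ hat l → rep a ∈ ∣ L ∣
      rep-on-line a (v∈L , _) = rep-∈ a L v∈L

      reps-⊥ : ∀ a b → proj₁ a ∈ hat l → proj₁ b ∈ hat l → B (rep a) (rep b) ≡ 0#
      reps-⊥ a b a∈l b∈l = TotallySingular⇒⊥ {L} L-ts (rep-on-line a a∈l) (rep-on-line b b∈l)

    opaque
      l^∞≐P∞ : (l ^∞) ≐ ｛ P∞ ｝ᴾ
      l^∞≐P∞ = (λ {z} → to {z}) , λ {z} z∼p → pts-resp L {P∞} {z} (≐-sym z∼p) p∞∈L
                  , L-ts _ (pts-resp L {P∞} {z} (≐-sym z∼p) p∞∈L)
                  , pts-resp H₀ {P∞} {z} (≐-sym z∼p) p∞∈H₀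
        where
        to : (l ^∞) ⊆ ｛ P∞ ｝ᴾ
        to {z , z≢0} (z∈L , _ , z∈H₀) with c , eq ← line∩H₀ z∈L z∈H₀ = ∼-intro z≢0 p∞≢0 c eq

    private
      coordinate : ∀ a → proj₁ a ∈ hat l → ∃ λ c → rep a ≡ origin +ᵛ c • p∞
      coordinate a a∈l = line-coordinate origin-affine origin∈L (rep-affine a) (rep-on-line a a∈l)

      member : Carrier → ∃ (φ₀-line l)
      member c = φ a , a , hat-point (translate-affine c) (translate-∈ c) , ≐-refl
        where
        a : AffinePoint
        a = point (translate-affine c)

      coord : ∃ (φ₀-line l) → Carrier
      coord (_ , a , a∈l , _) = proj₁ (coordinate a a∈l)

    opaque
      -- Points of a line are mutually orthogonal, so two of them with the same ovoid coincide and
      -- have the same parameter.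
      coord-cong : ∀ {X Y} → proj₁ X ≈ᴼ proj₁ Y → coord X ≡ coord Y
      coord-cong {_ , a , a∈l , X≐φa} {_ , b , b∈l , Y≐φb} X≈Y = translate-injective (begin
        _       ≡⟨ proj₂ (coordinate a a∈l) ⟨
        rep a   ≡⟨ ∼⇒rep≡ b a (φ⊆∧⊥⇒∼ a b (λ {z} → proj₁ φa≐φb {z}) (reps-⊥ a b a∈l b∈l)) ⟨
        rep b   ≡⟨ proj₂ (coordinate b b∈l) ⟩
        _       ∎)
        where
        φa≐φb : φ₀-pt a ≐ φ₀-pt b
        φa≐φb = ≐-trans (≐-sym X≐φa) (≐-trans X≈Y Y≐φb)

      coord-member : ∀ c → coord (member c) ≡ c
      coord-member c = translate-injective (begin
        _                                    ≡⟨ proj₂ (coordinate (point (translate-affine c)) _) ⟨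
        rep (point (translate-affine c))     ≡⟨ rep-point (translate-affine c) ⟩
        _                                    ∎)

      member-coord : ∀ X → proj₁ (member (coord X)) ≈ᴼ proj₁ X
      member-coord (_ , a , a∈l , X≐φa) = ≐-trans (rep≡⇒φ≐ (point (translate-affine c)) a (begin
        rep (point (translate-affine c))     ≡⟨ rep-point (translate-affine c) ⟩
        origin +ᵛ c • p∞                     ≡⟨ proj₂ (coordinate a a∈l) ⟨
        rep a                                ∎)) (≐-sym X≐φa)
        where
        c : Carrier
        c = proj₁ (coordinate a a∈l)

    φ₀-line-size : HasSize (Sub Ovoids (φ₀-line l)) q
    φ₀-line-size = record
      { to        = λ X → index (coord X)
      ; from      = λ i → member (element i)
      ; to-cong   = λ {X} {Y} X≈Y → cong index (coord-cong {X} {Y} X≈Y)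
      ; from-cong = λ { refl → ≐-refl }
      ; inverse   =
          (λ {i} {X} X≈ → trans (cong index (trans (coord-cong {X} {member (element i)} X≈) (coord-member (element i))))
                            (index-element i))
        , (λ { {X} refl → ≐-trans (≐-reflexive (cong (λ c → proj₁ (member c)) (element-index (coord X)))) (member-coord X) })
      }
      where
      ≐-reflexive : ∀ {X Y : Ovoid} → X ≡ Y → X ≈ᴼ Y
      ≐-reflexive refl = ≐-refl

    opaque
      -- A common point of the two ovoids is orthogonal to two points of the line, hence to all of
      -- it, and by maximality lies on it; inside `H₀` only the point at infinity remains.
      φ₀-line-pairwise : ∀ X Y → X ∈ φ₀-line l → Y ∈ φ₀-line l → ¬ (X ≈ᴼ Y) → (proj₁ X ∩ proj₁ Y) ≐ ｛ P∞ ｝ᴾ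
      φ₀-line-pairwise X Y (a , a∈l , X≐φa) (b , b∈l , Y≐φb) X≉Y = to , from
        where
        ra∈L : rep a ∈ ∣ L ∣
        ra∈L = rep-on-line a a∈l
        to : (proj₁ X ∩ proj₁ Y) ⊆ ｛ P∞ ｝ᴾ
        to {z , z≢0} (z∈X , z∈Y)
          with (z∈H₀ , Baz) , fz , _ ← proj₁ (φ₀-pt≐solid a) {z , z≢0} (proj₁ X≐φa {z , z≢0} z∈X)
          with (_ , Bbz) , _ ← proj₁ (φ₀-pt≐solid b) {z , z≢0} (proj₁ Y≐φb {z , z≢0} z∈Y)
          with c , eq ← line-coordinate (rep-affine a) ra∈L (rep-affine b) (rep-on-line b b∈l)
          = by (line∩H₀ (maximal-TotallySingular {L} L-dim L-ts fz
                 (vanishes-on-line (B-linear z) (rep-affine a) ra∈L (B-sym-≡ Baz) Bzp)) z∈H₀)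
          where
          by : (∃ λ c → z ≡ c • p∞) → (z , z≢0) ∼ P∞
          by (c , eq) = ∼-intro z≢0 p∞≢0 c eq
          Bzp : B z p∞ ≡ 0#
          -- If `z` were not orthogonal to `p∞`, then `c` would vanish and both ovoids would come
          -- from the same point.
          Bzp = decidable-stable (B z p∞ ≟ 0#) λ Bzp≢0 → X≉Y (≐-trans X≐φa (≐-trans (rep≡⇒φ≐ a b
            (sym (trans eq (trans (cong (λ c → rep a +ᵛ c • p∞)
              (+•-kernel-coefficient (B-linear z) (B-sym-≡ Baz) Bzp≢0 (trans (cong (B z) (sym eq)) (B-sym-≡ Bbz))))
              (u+0•v≡u (rep a) p∞))))) (≐-sym Y≐φb)))
        p∈φ : ∀ (c : AffinePoint) → proj₁ c ∈ hat l → P∞ ∈ φ₀-pt c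
        p∈φ c c∈l = proj₂ (φ₀-pt≐solid c) {P∞}
          ((p∞∈H₀ , TotallySingular⇒⊥ {L} L-ts (rep-on-line c c∈l) p∞∈L) , L-ts p∞ p∞∈L , p∞∈H₀)
        resp-φ : ∀ c {z : ProjPoint} → z ∼ P∞ → P∞ ∈ φ₀-pt c → z ∈ φ₀-pt c
        resp-φ c {z} z∼p p∈φc with p∈S , fp , _ ← proj₁ (φ₀-pt≐solid c) {P∞} p∈φc
          = proj₂ (φ₀-pt≐solid c) {z}
              ( pts-resp (solid (rep c)) {P∞} {z} (≐-sym z∼p) p∈S
              , L-ts _ (pts-resp L {P∞} {z} (≐-sym z∼p) p∞∈L)
              , pts-resp H₀ {P∞} {z} (≐-sym z∼p) p∞∈H₀)
        from : ｛ P∞ ｝ᴾ ⊆ (proj₁ X ∩ proj₁ Y)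
        from {z} z∼p = proj₂ X≐φa (resp-φ a {z} z∼p (p∈φ a a∈l)) , proj₂ Y≐φb (resp-φ b {z} z∼p (p∈φ b b∈l))

    rosette : IsRosetteBasedAt P∞ (φ₀-line l)
    rosette = record
      { base     = L-ts p∞ p∞∈L , p∞∈H₀
      ; resp     = λ X≈Y (a , a∈l , X≐φa) → a , a∈l , ≐-trans (≐-sym X≈Y) X≐φa
      ; size     = φ₀-line-size
      ; pairwise = φ₀-line-pairwise
      }

  wellDefined : WellDefined
  wellDefined = record
    { ovoid   = ovoid
    ; rosette = λ l → P∞ l , l^∞≐P∞ l , rosette l
    }

  open WellDefined wellDefined using (φ₀ᴾ; φ₀ᴸ)

  -- If b is on l and φ b = φ c with c on m, then c is not the twin b + ν of b, since the common point of
  -- l and m is orthogonal to both b and c but not to ν.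
  opaque
    hat-⊆ : ∀ (a : AffinePoint) l m → proj₁ a ∈ hat l → proj₁ a ∈ hat m → φ₀-line l ⊆ φ₀-line m → hat l ⊆ hat m
    hat-⊆ a l m a∈l a∈m φl⊆φm {v} v∈l@(v∈L , v∉) = by (φl⊆φm {φ b} (b , v∈l , ≐-refl))
      where
      b : AffinePoint
      b = v , AffineLine.totallySingular l _ v∈L , λ v∈Q₀ → v∉ (v∈L , v∈Q₀)
      by : φ₀-line m (φ b) → v ∈ hat m
      by (c , c∈m , φb≐φc) = Geometry.I-respᴾ 𝒳̂ {c} {b} {m} (rep≡⇒∼ c b (same (φ⊆⇒rep b c (λ {z} → proj₁ φb≐φc {z})))) c∈m
        where
        same : rep c ≡ rep b ⊎ rep c ≡ rep b +ᵛ ν → rep c ≡ rep b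
        same (inj₁ eq) = eq
        same (inj₂ eq) = contradiction (begin
          0#                               ≡⟨ reps-⊥ m a c a∈m c∈m ⟨
          B (rep a) (rep c)                ≡⟨ cong (B (rep a)) eq ⟩
          B (rep a) (rep b +ᵛ ν)           ≡⟨ B-+ʳ (rep a) (rep b) ν ⟩
          B (rep a) (rep b) + B (rep a) ν  ≡⟨ cong₂ _+_ (reps-⊥ l a b a∈l v∈l) (ν-valueʳ (rep-affine a)) ⟩
          0# + 1#                          ≡⟨ +-identityˡ 1# ⟩
          1#                               ∎) 0≢1

  -- Rosettes through a given ovoid lift to lines.

  module _ {x : V} (ax : Affine x) (p : V) (p≢0 : p ≢ 0ᵛ) (fp : f p ≡ 0#) (p∈S : p ∈ ∣ solid x ∣) where
    private
      ⟨p⟩ : Subspace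
      ⟨p⟩ = adjoin p zeroSubspace

      ⟨p⟩-vanish : ∀ {g} → IsLinear g → g p ≡ 0# → ∀ {u} → u ∈ ∣ ⟨p⟩ ∣ → g u ≡ 0#
      ⟨p⟩-vanish {g} lin gp (c , _ , eq) = kernel-+•⁻¹ lin (trans (cong g eq) (IsLinear.0-homo lin)) gp

    opaque
      join-ts : TotallySingular f (adjoin x ⟨p⟩)
      join-ts = TotallySingular-adjoin {⟨p⟩}
        (TotallySingular-adjoin {zeroSubspace} TotallySingular-zero fp
          (λ (_ , t≡0) → trans (cong (B p) t≡0) (IsLinear.0-homo (B-linear p))))
        (singular ax) (⟨p⟩-vanish (B-linear x) (proj₂ p∈S))

      join-dim : HasDim (adjoin x ⟨p⟩) 2
      join-dim = HasDim-adjoin {x} {⟨p⟩}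
        (λ x∈⟨p⟩ → 0≢1 (trans (sym (⟨p⟩-vanish (B-linear ν) (ν⊥H₀ (proj₁ p∈S)) x∈⟨p⟩)) (ν-value ax)))
        (HasDim-adjoin {p} {zeroSubspace} (v∉0 p≢0) HasDim-zero)

    join : AffineLine
    join = record
      { line            = adjoin x ⟨p⟩
      ; dimension       = join-dim
      ; totallySingular = join-ts
      ; notInQ₀         = λ ⊆Q₀ → ∉H₀ ax (proj₂ (⊆Q₀ {x , affine≢0 ax} (∈-adjoin x ⟨p⟩)))
      }

    x∈join : x ∈ ∣ line join ∣
    x∈join = ∈-adjoin x ⟨p⟩

    x+cp∈join : ∀ c → x +ᵛ c • p ∈ ∣ line join ∣
    x+cp∈join c = +-closed (line join) x∈join
      (•-closed (line join) c (⊆-adjoin x ⟨p⟩ (∈-adjoin p zeroSubspace)))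

  module _ (a : AffinePoint) (R : Pred Ovoid 0ℓ) (p : ProjPoint) (R-rosette : IsRosetteBasedAt p R)
           (φa∈R : φ a ∈ R) where
    open IsRosetteBasedAt R-rosette
    private
      module N = Size (Sub Ovoids R) size
      x : V
      x = rep a
      ax : Affine x
      ax = rep-affine a
      Φa : ∃ R
      Φa = φ a , φa∈R

    opaque
      -- As 0 and 1 differ, two distinct numbers are available, and the member with at least one of
      -- them is not `φ a`. A second member is what lets `pairwise` place the base on `φ a`.
      another : ∃ λ (Y : ∃ R) → ¬ (φ a ≈ᴼ proj₁ Y)
      another with N.number Φa Fin.≟ index 0#
      ... | no ≢0  = N.member (index 0#) , λ eq → ≢0
        (trans (N.number-cong {Φa} {N.member (index 0#)} eq) (N.number-member (index 0#)))
      ... | yes ≡0 = N.member (index 1#) , λ eq → 0≢1 (index-injective (trans (sym ≡0)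
        (trans (N.number-cong {Φa} {N.member (index 1#)} eq) (N.number-member (index 1#)))))

      base∈φa : p ∈ φ₀-pt a
      base∈φa with (Y , Y∈R) , φa≉Y ← another =
        proj₁ (proj₂ (pairwise (φ a) Y φa∈R Y∈R φa≉Y) {p} ≐-refl)

    p∈S : proj₁ p ∈ ∣ solid x ∣
    p∈S = proj₁ (proj₁ (φ₀-pt≐solid a) {p} base∈φa)

    l : AffineLine
    l = join ax (proj₁ p) (proj₂ p) (proj₁ base) p∈S

    a∈l : proj₁ a ∈ hat l
    a∈l = ∈-rep a (line l) (x∈join ax (proj₁ p) (proj₂ p) (proj₁ base) p∈S) , λ (_ , a∈Q₀) → proj₂ (proj₂ a) a∈Q₀

    opaque
      -- A member other than `φ a` is the ovoid of some `w` and meets `φ a` only in the base, so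
      -- `tangent` places `w` or its twin on the line joining `x` to the base.
      R⊆φl : R ⊆ φ₀-line l
      R⊆φl {Y} Y∈R with N.number Φa Fin.≟ N.number (Y , Y∈R)
      ... | yes eq = a , a∈l , ≐-sym (N.number-injective {Φa} {Y , Y∈R} eq)
      ... | no neq = by (φ-surjective Y)
        where
        φa∩Y : (φ₀-pt a ∩ proj₁ Y) ≐ ｛ p ｝ᴾ
        φa∩Y = pairwise (φ a) Y φa∈R Y∈R λ eq → neq (N.number-cong {Φa} {Y , Y∈R} eq)
        by : (∃ λ w → Σ (Affine w) λ aw → φ (point aw) ≈ᴼ Y) → φ₀-line l Y
        by (w , aw , φw≐Y) = conclude (tangent ax aw (proj₂ p) p∈S (proj₁ base) Bwp only-p)
          where
          ∈S-w : ∀ {z} → z ∈ Q₀ → z ∈ proj₁ Y → B w (proj₁ z) ≡ 0#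
          ∈S-w {z} _ z∈Y = subst (λ w → B w (proj₁ z) ≡ 0#) (rep-point aw)
            (proj₂ (proj₁ (proj₁ (φ₀-pt≐solid (point aw)) {z} (proj₂ φw≐Y z∈Y))))
          Bwp : B w (proj₁ p) ≡ 0#
          Bwp = ∈S-w {p} base (proj₂ (proj₂ φa∩Y {p} ≐-refl))
          only-p : ∀ {z} → z ∈ ∣ solid x ∣ → f z ≡ 0# → B w z ≡ 0# → B (proj₁ p) z ≡ 0#
          only-p {z} z∈S fz Bwz with z ≟ᵛ 0ᵛ
          ... | yes z≡0 = trans (cong (B (proj₁ p)) z≡0) (IsLinear.0-homo (B-linear (proj₁ p)))
          ... | no z≢0 = multiple (∼-elim {z , z≢0} {p} (proj₁ φa∩Y {z , z≢0}
                ( proj₂ (φ₀-pt≐solid a) {z , z≢0} (z∈S , fz , proj₁ z∈S)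
                , proj₁ φw≐Y {z , z≢0} (Bwz , fz , proj₁ z∈S))))
            where
            multiple : (∃ λ c → z ≡ c • proj₁ p) → B (proj₁ p) z ≡ 0#
            multiple (c , eq) = trans (cong (B (proj₁ p)) eq) (trans (B-•ʳ c _ _)
              (trans (cong (c *_) (B-alternating (proj₁ p))) (zeroʳ c)))
          conclude : (∃ λ c → w ≡ x +ᵛ c • proj₁ p ⊎ w ≡ x +ᵛ c • proj₁ p +ᵛ ν) → φ₀-line l Y
          -- `b` is the point `x +ᵛ c • proj₁ p` of the line; `w` is this vector or its twin, with
          -- the same ovoid either way.
          conclude (c , eq) = b , hat-point l ab b∈L , ≐-trans (≐-sym φw≐Y) (φw≐φb eq)
            where
            b∈L : x +ᵛ c • proj₁ p ∈ ∣ line l ∣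
            b∈L = x+cp∈join ax (proj₁ p) (proj₂ p) (proj₁ base) p∈S c
            ab : Affine (x +ᵛ c • proj₁ p)
            ab = affine (AffineLine.totallySingular l _ b∈L)
              (trans (B-+•ʳ ν x c _) (trans (cong₂ (λ y z → y + c * z) (ν-value ax) (ν⊥H₀ (proj₁ p∈S)))
                (solve 1 (λ c → :1 :+ c :* :0 := :1) refl c)))
            b : AffinePoint
            b = point ab
            φw≐φb : w ≡ x +ᵛ c • proj₁ p ⊎ w ≡ x +ᵛ c • proj₁ p +ᵛ ν → φ₀-pt (point aw) ≐ φ₀-pt b
            φw≐φb (inj₁ eq) = rep≡⇒φ≐ (point aw) b (trans (rep-point aw) (trans eq (sym (rep-point ab))))
            φw≐φb (inj₂ eq) = rep-twin⇒φ≐ (point aw) b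
              (trans (rep-point aw) (trans eq (cong (_+ᵛ ν) (sym (rep-point ab)))))

    opaque
      φl≐R : φ₀-line l ≐ R
      φl≐R = (λ {X} → ⊆∧size⇒⊇ Ovoids {R = R} {φ₀-line l} (λ {X} {Y} → resp {X} {Y}) (λ {X} → R⊆φl {X})
               size (φ₀-line-size l) {X})
           , λ {X} → R⊆φl {X}

  -- The covering property and the fibres.

  isMorphism : IsMorphism 𝒳̂ 𝒳 φ₀ᴾ φ₀ᴸ
  isMorphism = record
    { congᴾ = λ {a} {b} a∼b → rep≡⇒φ≐ a b (∼⇒rep≡ a b a∼b)
    ; congᴸ = λ {l} {m} l≐m → (λ (a , a∈l , eq) → a , proj₁ l≐m {proj₁ a} a∈l , eq)
                            , (λ (a , a∈m , eq) → a , proj₂ l≐m {proj₁ a} a∈m , eq)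
    ; pres  = λ {a} a∈l → a , a∈l , ≐-refl
    }

  isCovering : IsCovering 𝒳̂ 𝒳 φ₀ᴾ φ₀ᴸ
  isCovering = record
    { isMorphism = isMorphism
    ; bijᴾ = λ l →
        -- Two points of a line with the same ovoid are orthogonal, hence equal rather than twins.
        (λ {(a , a∈l)} {(b , b∈l)} φa≐φb → φ⊆∧⊥⇒∼ b a (λ {z} → proj₂ φa≐φb {z}) (reps-⊥ l b a b∈l a∈l))
      , λ (X , a , a∈l , X≐φa) → (a , a∈l) , λ {(b , _)} b∼a →
          ≐-trans (IsMorphism.congᴾ isMorphism {b} {a} b∼a) (≐-sym X≐φa)
    ; bijᴸ = λ a →
        (λ {(l , a∈l)} {(m , a∈m)} φl≐φm →
            (λ {x} → hat-⊆ a l m a∈l a∈m (λ {X} → proj₁ φl≐φm {X}) {x})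
          , (λ {x} → hat-⊆ a m l a∈m a∈l (λ {X} → proj₂ φl≐φm {X}) {x}))
      -- A rosette through `φ a` lifts to the line joining `a` to its base.
      , λ ((R , p , R-rosette) , φa∈R) → (l a R p R-rosette φa∈R , a∈l a R p R-rosette φa∈R) ,
          λ {(m , _)} m≐l → ≐-trans (IsMorphism.congᴸ isMorphism {m} {l a R p R-rosette φa∈R} m≐l)
            (φl≐R a R p R-rosette φa∈R)
    }

  module Fibre {x : V} (ax : Affine x) where
    a a′ : AffinePoint
    a  = point ax
    a′ = point (twin-affine ax)

    opaque
      φa′≐φa : φ₀-pt a′ ≐ φ₀-pt a
      φa′≐φa = rep-twin⇒φ≐ a′ a (trans (rep-point (twin-affine ax)) (cong (_+ᵛ ν) (sym (rep-point ax))))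

      B-a-a′ : B (rep a) (rep a′) ≡ 1#
      B-a-a′ = trans (cong₂ B (rep-point ax) (rep-point (twin-affine ax))) (twin-not-⊥ ax)

      a≁a′ : ¬ (proj₁ a ∼ proj₁ a′)
      a≁a′ a∼a′ = 0≢1 (trans (sym (B-alternating (rep a))) (trans (cong (B (rep a)) (∼⇒rep≡ a a′ a∼a′)) B-a-a′))

      φ-fibre : ∀ b → φ₀-pt b ≐ φ₀-pt a → proj₁ b ∼ proj₁ a ⊎ proj₁ b ∼ proj₁ a′
      φ-fibre b φb≐φa with φ⊆⇒rep a b (λ {z} → proj₂ φb≐φa {z})
      ... | inj₁ eq = inj₁ (rep≡⇒∼ b a eq)
      ... | inj₂ eq = inj₂ (rep≡⇒∼ b a′ (trans eq (trans (cong (_+ᵛ ν) (rep-point ax))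
              (sym (rep-point (twin-affine ax))))))

  fibreᴾ : ∀ Y → HasSize (Sub (Geometry.Points 𝒳̂) (λ x → φ₀ᴾ x ≈ᴼ Y)) 2
  fibreᴾ Y = two-elements (Sub (Geometry.Points 𝒳̂) (λ x → φ₀ᴾ x ≈ᴼ Y))
    {a , φa≐Y} {a′ , ≐-trans φa′≐φa φa≐Y} a≁a′
    λ (b , φb≐Y) → φ-fibre b (≐-trans φb≐Y (≐-sym φa≐Y))
    where
    open Fibre (proj₁ (proj₂ (φ-surjective Y)))
    φa≐Y : φ a ≈ᴼ Y
    φa≐Y = proj₂ (proj₂ (φ-surjective Y))

  -- A member of the rosette is the ovoid of exactly two points `a` and `a′`, and the lines joining
  -- these to the base are two lifts. Every lift passes through `a` or `a′`, and `hat-⊆` identifies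
  -- it with the one of the two through that point.
  fibreᴸ : ∀ M → HasSize (Sub (Geometry.Lines 𝒳̂) (λ l → Setoid._≈_ Rosettes (φ₀ᴸ l) M)) 2
  fibreᴸ M@(R , p , R-rosette) = two-elements (Sub (Geometry.Lines 𝒳̂) (λ l → Setoid._≈_ Rosettes (φ₀ᴸ l) M))
    {l₁ , φl≐R a R p R-rosette φa∈R} {l₂ , φl≐R a′ R p R-rosette φa′∈R} l₁≉l₂ cases
    where
    open IsRosetteBasedAt R-rosette using (size; resp)
    X : ∃ R
    X = Inverse.from size (index 0#)
    open Fibre (proj₁ (proj₂ (φ-surjective (proj₁ X))))
    φa≐X : φ a ≈ᴼ proj₁ X
    φa≐X = proj₂ (proj₂ (φ-surjective (proj₁ X)))
    φa∈R : φ a ∈ R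
    φa∈R = resp {proj₁ X} {φ a} (≐-sym φa≐X) (proj₂ X)
    φa′∈R : φ a′ ∈ R
    φa′∈R = resp {φ a} {φ a′} (≐-sym φa′≐φa) φa∈R
    l₁ l₂ : AffineLine
    l₁ = l a R p R-rosette φa∈R
    l₂ = l a′ R p R-rosette φa′∈R
    a∈l₁ : proj₁ a ∈ hat l₁
    a∈l₁ = a∈l a R p R-rosette φa∈R
    a′∈l₂ : proj₁ a′ ∈ hat l₂
    a′∈l₂ = a∈l a′ R p R-rosette φa′∈R
    l₁≉l₂ : ¬ (hat l₁ ≐ hat l₂)
    -- A common line would make the twins `a` and `a′` orthogonal.
    l₁≉l₂ l₁≐l₂ = 0≢1 (trans (sym (reps-⊥ l₂ a a′ (proj₁ l₁≐l₂ {proj₁ a} a∈l₁) a′∈l₂)) B-a-a′)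
    through : ∀ (c : AffinePoint) m n → proj₁ c ∈ hat m → proj₁ c ∈ hat n → φ₀-line m ≐ R → φ₀-line n ≐ R → hat m ≐ hat n
    through c m n c∈m c∈n φm≐R φn≐R = (λ {x} → hat-⊆ c m n c∈m c∈n (λ {X} X∈ → proj₂ φn≐R {X} (proj₁ φm≐R {X} X∈)) {x})
                                    , (λ {x} → hat-⊆ c n m c∈n c∈m (λ {X} X∈ → proj₂ φm≐R {X} (proj₁ φn≐R {X} X∈)) {x})
    cases : ∀ ((m , _) : ∃ λ m → φ₀-line m ≐ R) → hat m ≐ hat l₁ ⊎ hat m ≐ hat l₂
    cases (m , φm≐R) with b , b∈m , φa≐φb ← proj₂ φm≐R {φ a} φa∈R with φ-fibre b ((λ {z} → proj₂ φa≐φb {z}) , (λ {z} → proj₁ φa≐φb {z}))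
    ... | inj₁ b∼a  = inj₁ (through a m l₁ (Geometry.I-respᴾ 𝒳̂ {b} {a} {m} b∼a b∈m) a∈l₁ φm≐R
                        (φl≐R a R p R-rosette φa∈R))
    ... | inj₂ b∼a′ = inj₂ (through a′ m l₂ (Geometry.I-respᴾ 𝒳̂ {b} {a′} {m} b∼a′ b∈m) a′∈l₂ φm≐R
                        (φl≐R a′ R p R-rosette φa′∈R))

  isFoldCovering : IsFoldCovering 𝒳̂ 𝒳 2 φ₀ᴾ φ₀ᴸ
  isFoldCovering = record
    { isCovering = isCovering
    ; fibreᴾ     = fibreᴾ
    ; fibreᴸ     = fibreᴸ
    }

theorem1 :
    (n : ℕ) (F : FiniteField (2 ^ n)) →
    (let open VectorSpace F 6) →
    (f : V → FiniteField.Carrier F) →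
    IsQuadraticForm f →
    NonDegenerateOn f whole →
    HasWittIndexOn f whole 2 →
    (H₀ : Subspace) →
    HasDim H₀ 5 →
    NonDegenerateOn f H₀ →
    (let open Quadric F f H₀) →
    Σ WellDefined λ wd →
      IsFoldCovering 𝒳̂ 𝒳 2 (WellDefined.φ₀ᴾ wd) (WellDefined.φ₀ᴸ wd)
theorem1 n F f isQuadratic f-nondeg f-witt H₀ H₀-dim H₀-nondeg = wellDefined , isFoldCovering
  where open Covering F (1+1≡0 n F) f isQuadratic f-nondeg f-witt H₀ H₀-dim H₀-nondeg
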